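{- Let $q$ be a power of $2$. For every odd integer $n>1$, one has $$\mathcal U_n(B,C),\ \Lambda_n(B,C)\in\mathbb F_q[B^2,C].$$
   Context: Let $B,C$ be algebraically independent indeterminates over $\mathbb F_q$. The Lucas polynomials of the first type are $\mathcal U_0=0$, $\mathcal U_1=1$, $\mathcal U_n=-B\,\mathcal U_{n-1}-C\,\mathcal U_{n-2}$ for $n\ge2$. Lucas atoms: let $\alpha,\beta$ be the two roots of $T^2+BT+C$ in an algebraic closure of $\mathbb F_q(B,C)$. Let $\Phi_n(X)\in\mathbb F_q[X]$ be the $n$-th cyclotomic polynomial (the image of the integral one), $\varphi$ Euler's totient function, and $\Phi_n^{\mathrm{hom}}(\alpha,\beta)=\beta^{\varphi(n)}\Phi_n(\alpha/\beta)$. For $n\ge2$ the $n$-th Lucas atom $\Lambda_n(B,C)\in\mathbb F_q[B,C]$ is the unique polynomial with $\Lambda_n(B,C)=\Phi_n^{\mathrm{hom}}(\alpha,\beta)$. -}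

module Defs where

open import Algebra.Bundles using (RawRing; CommutativeRing)
open import Algebra.Morphism.Structures using (module RingMorphisms)
import Algebra.Definitions.RawSemiring as RawSemiringDefinitions
open import Data.Integer.Base using (ℤ; +_; -[1+_])
import Data.Integer.Properties as ℤ
open import Data.List.Base using (List; []; _∷_; map; foldr; filter; length; applyUpTo)
open import Data.Nat.Base using (ℕ; zero; suc; NonZero)
open import Data.Nat.Coprimality using (coprime?)
open import Data.Nat.Divisibility using (_∣?_)
open import Data.Product.Base using (_×_; ∃; ∃-syntax)
open import Level using (Level; _⊔_) renaming (suc to lsuc)
open import Relation.Nullary.Negation.Core using (¬_)

private
  variable
    c ℓ c₁ ℓ₁ c₂ ℓ₂ : Level

-- The inverse is total, with an unspecified value at 0#.
record Field c ℓ : Set (lsuc (c ⊔ ℓ)) where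
  infix 9 _⁻¹
  infixl 7 _/_
  field
    commutativeRing : CommutativeRing c ℓ
  open CommutativeRing commutativeRing public
  field
    _⁻¹        : Carrier → Carrier
    ⁻¹-cong    : ∀ {x y} → x ≈ y → x ⁻¹ ≈ y ⁻¹
    ⁻¹-inverse : ∀ x → ¬ (x ≈ 0#) → x * x ⁻¹ ≈ 1#
    1≉0        : ¬ (1# ≈ 0#)

  _/_ : Carrier → Carrier → Carrier
  x / y = x * y ⁻¹

-- Polynomials are coefficient lists, constant coefficient first.  Trailing
-- zeros are allowed: equality compares all coefficients.
module Poly (R : RawRing c ℓ) where
  open RawRing R

  coeff : List Carrier → ℕ → Carrier
  coeff []      _       = 0#
  coeff (a ∷ p) zero    = a
  coeff (a ∷ p) (suc i) = coeff p i

  infix 4 _≋_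
  record _≋_ (p q : List Carrier) : Set ℓ where
    constructor mk≋
    field
      coeff≈ : ∀ i → coeff p i ≈ coeff q i

  infixl 6 _⊕_
  _⊕_ : List Carrier → List Carrier → List Carrier
  []      ⊕ q       = q
  (a ∷ p) ⊕ []      = a ∷ p
  (a ∷ p) ⊕ (b ∷ q) = (a + b) ∷ (p ⊕ q)

  infixl 7 _⊗_
  _⊗_ : List Carrier → List Carrier → List Carrier
  []      ⊗ q = []
  (a ∷ p) ⊗ q = map (a *_) q ⊕ (0# ∷ (p ⊗ q))

  polyRing : RawRing c ℓ
  polyRing = record
    { Carrier = List Carrier
    ; _≈_     = _≋_
    ; _+_     = _⊕_
    ; _*_     = _⊗_
    ; -_      = map (-_)
    ; 0#      = []
    ; 1#      = 1# ∷ []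
    }

  const : Carrier → List Carrier
  const a = a ∷ []

  X : List Carrier
  X = 0# ∷ 1# ∷ []

infix 9 _[X]
_[X] : RawRing c ℓ → RawRing c ℓ
R [X] = Poly.polyRing R

∣_∣ : RawRing c ℓ → Set c
∣ R ∣ = RawRing.Carrier R

-- Value at s of the image of a polynomial under a coefficient map f : R → S.
eval₂ : (R : RawRing c ℓ) (S : RawRing c₁ ℓ₁) →
        (∣ R ∣ → ∣ S ∣) → ∣ S ∣ → ∣ R [X] ∣ → ∣ S ∣
eval₂ R S f s = foldr (λ a v → f a + s * v) 0#
  where open RawRing S

eval : (R : RawRing c ℓ) → ∣ R ∣ → ∣ R [X] ∣ → ∣ R ∣
eval R = eval₂ R R (λ a → a)

fromℤ : (R : RawRing c ℓ) → ℤ → ∣ R ∣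
fromℤ R z = go z
  where
  open RawRing R
  open RawSemiringDefinitions rawSemiring using () renaming (_×_ to _·_)
  go : ℤ → Carrier
  go (+ n)    = n · 1#
  go -[1+ n ] = - (suc n · 1#)

-- F[B][C]: the inner variable is B, the outer one C.
module Bivariate (F : Field c ℓ) where
  private
    F₀ = Field.rawRing F

  F[B,C] : RawRing c ℓ
  F[B,C] = F₀ [X] [X]

  open RawRing F[B,C]
  open RawSemiringDefinitions rawSemiring using (_^_)

  scalar : Field.Carrier F → Carrier
  scalar a = Poly.const (F₀ [X]) (Poly.const F₀ a)

  B C : Carrier
  B = Poly.const (F₀ [X]) (Poly.X F₀)
  C = Poly.X (F₀ [X])

  substBC : Carrier → Carrier → Carrier → Carrier
  substBC u v = eval₂ (F₀ [X]) F[B,C] (eval₂ F₀ F[B,C] scalar u) v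

  infix 4 _∈F[B²,C]
  _∈F[B²,C] : Carrier → Set (c ⊔ ℓ)
  P ∈F[B²,C] = ∃[ Q ] P ≈ substBC (B ^ 2) C Q

  𝒰 : ℕ → Carrier
  𝒰 0             = 0#
  𝒰 1             = 1#
  𝒰 (suc (suc n)) = (- B) * 𝒰 (suc n) + - (C * 𝒰 n)

ℤ₀ : RawRing _ _
ℤ₀ = CommutativeRing.rawRing ℤ.+-*-commutativeRing

-- ∏_{d ∣ n} Φ_d = Xⁿ - 1 for all n ≥ 1.  Solving recursively for Φ_n, this
-- determines every Φ_n with n ≥ 1, as each Xⁿ - 1 is monic; Φ 0 is irrelevant.
IsCyclotomic : (ℕ → ∣ ℤ₀ [X] ∣) → Set
IsCyclotomic Φ = ∀ n → .{{NonZero n}} →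
    foldr _*_ 1# (map Φ (filter (_∣? n) (applyUpTo suc n)))
  ≈ Poly.X ℤ₀ ^ n + - 1#
  where
  open RawRing (ℤ₀ [X])
  open RawSemiringDefinitions rawSemiring using (_^_)

φ : ℕ → ℕ
φ n = length (filter (λ k → coprime? k n) (applyUpTo suc n))

record IsFractionField (A : RawRing c ℓ) (L : Field c₁ ℓ₁)
                       (ι : ∣ A ∣ → Field.Carrier L) : Set (c ⊔ ℓ ⊔ c₁ ⊔ ℓ₁) where
  private
    module A = RawRing A
    module L = Field L
  field
    isRingMonomorphism : RingMorphisms.IsRingMonomorphism A L.rawRing ι
    fraction           : ∀ x → ∃[ a ] ∃[ s ] (¬ (s A.≈ A.0#) × x L.≈ ι a L./ ι s)

record IsAlgebraicClosure (L : Field c₁ ℓ₁) (K : Field c₂ ℓ₂)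
                          (j : Field.Carrier L → Field.Carrier K) :
                          Set (c₁ ⊔ ℓ₁ ⊔ c₂ ⊔ ℓ₂) where
  private
    module L = Field L
    module K = Field K
    module L[X] = RawRing (L.rawRing [X])
  field
    isRingMonomorphism : RingMorphisms.IsRingMonomorphism L.rawRing K.rawRing j
    algebraic          : ∀ x → ∃[ p ] (¬ (p L[X].≈ L[X].0#)
                           × eval₂ L.rawRing K.rawRing j x p K.≈ K.0#)
    algebraicallyClosed : ∀ p i → ¬ (Poly.coeff K.rawRing p (suc i) K.≈ K.0#) →
                          ∃[ x ] eval K.rawRing x p K.≈ K.0#

record AlgebraicClosureOfRationalFunctions (F : Field c ℓ) c₁ ℓ₁ c₂ ℓ₂ :
         Set (c ⊔ ℓ ⊔ lsuc (c₁ ⊔ ℓ₁ ⊔ c₂ ⊔ ℓ₂)) where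
  open Bivariate F
  field
    F⟨B,C⟩             : Field c₁ ℓ₁
    ι                  : ∣ F[B,C] ∣ → Field.Carrier F⟨B,C⟩
    isFractionField    : IsFractionField F[B,C] F⟨B,C⟩ ι
    K                  : Field c₂ ℓ₂
    j                  : Field.Carrier F⟨B,C⟩ → Field.Carrier K
    isAlgebraicClosure : IsAlgebraicClosure F⟨B,C⟩ K j

  module K = Field K

  embed : ∣ F[B,C] ∣ → K.Carrier
  embed P = j (ι P)

  -- α and β are the two roots, with multiplicity, of T² + B T + C:
  -- T² + B T + C = (T - α)(T - β) in K[T].
  AreRoots : K.Carrier → K.Carrier → Set ℓ₂
  AreRoots α β =
      T ^ 2 + const (embed B) * T + const (embed C)
    ≈ (T + - const α) * (T + - const β)
    where
    open RawRing (K.rawRing [X])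
    open RawSemiringDefinitions rawSemiring using (_^_)
    open Poly K.rawRing using (const) renaming (X to T)

  Φhom : (ℕ → ∣ ℤ₀ [X] ∣) → ℕ → K.Carrier → K.Carrier → K.Carrier
  Φhom Φ n α β =
    (β ^ φ n) K.* eval₂ F₀ K.rawRing (λ a → embed (scalar a)) (α K./ β)
                        (map (fromℤ F₀) (Φ n))
    where
    F₀ = Field.rawRing F
    open RawSemiringDefinitions (RawRing.rawSemiring K.rawRing) using (_^_)

  record IsLucasAtom (Φ : ℕ → ∣ ℤ₀ [X] ∣) (n : ℕ) (α β : K.Carrier)
                     (Λ : ∣ F[B,C] ∣) : Set (c ⊔ ℓ ⊔ ℓ₂) where
    open RawRing F[B,C] using (_≈_)
    field
      embed-Λ : embed Λ K.≈ Φhom Φ n α β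
      unique  : ∀ Λ′ → embed Λ′ K.≈ Φhom Φ n α β → Λ′ ≈ Λ

{-# OPTIONS --safe #-}

-- In U_{n+2} = - B U_{n+1} - C U_n the parity in B alternates, so U_n lies in
-- F[B²,C] for odd n and in B F[B²,C] for even n.
--
-- For the atoms, put G_d(x,y) = y^φ(d) Φ_d(x/y).  Since ∑_{d ∣ n} φ(d) = n and
-- the characteristic is 2, ∏_{d ∣ n} G_d(α,β) = αⁿ + βⁿ = B U_n ≠ 0 for odd n.
-- This is symmetric in α, β, and cancelling the proper divisors inductively
-- shows G_n(α,β) = G_n(β,α).  As n is odd and > 1, φ(n) is even, so G_n is a
-- form of even degree; from α² = Bα + C, αβ = C, β² = B² + C + Bα it can be
-- written s + r Bα with s, r ∈ F[B²,C], and its conjugate is s + r Bβ.  Equality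
-- of the two gives r B² = 0, whence G_n(α,β) = s.

module Submission where

open import Defs
open import Algebra.Bundles using (CommutativeRing)
import Algebra.Morphism.Construct.Composition as Composition
import Algebra.Morphism.Construct.Identity as Identity
open import Algebra.Morphism.Structures using (module RingMorphisms)
import Algebra.Properties.CommutativeMonoid.Sum as CommutativeMonoidSum
open import Algebra.Properties.CommutativeSemigroup using (interchange)
import Algebra.Properties.CommutativeSemiring.Exp as CommutativeSemiringExp
import Algebra.Properties.Ring as RingProperties
import Algebra.Properties.Semiring.Exp as SemiringExp
import Algebra.Properties.Semiring.Mult as SemiringMult
import Algebra.Solver.Ring.NaturalCoefficients.Default as NaturalSolver
open import Data.Fin.Base using (Fin)
open import Data.Fin.Permutation using (permutation; _⟨$⟩ʳ_)
import Data.Fin.Properties as Fin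
open import Data.Integer.Base as ℤ using (ℤ)
import Data.Integer.Properties as ℤ
open import Data.List.Base using (List; []; _∷_; _++_; [_]; map; foldr)
import Data.List.Properties as List
open import Data.List.Relation.Unary.All as All using (All; []; _∷_)
open import Data.Nat.Base using (ℕ; zero; suc; _≤_; _<_; z≤n; s≤s; z<s; s<s; NonZero; >-nonZero)
  renaming (_+_ to _+ℕ_; _*_ to _*ℕ_; _^_ to _^ℕ_)
open import Data.Nat.Divisibility using (_∣_; divides; ∣-trans)
open import Data.Nat.Induction using (<-rec)
open import Data.Nat.ListAction using (sum)
import Data.Nat.Properties as ℕ
open import Data.Product.Base using (_×_; _,_; proj₁; proj₂; ∃-syntax)
open import Data.Sum.Base using (_⊎_; inj₁; inj₂)
open import Function.Base using (_∘_; case_of_)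
open import Function.Bundles using (Inverse)
open import Level using (Level)
open import Relation.Binary.Definitions using (tri<; tri≈; tri>)
open import Relation.Binary.PropositionalEquality as ≡ using (_≡_)
import Relation.Binary.Reasoning.Setoid as SetoidReasoning
open import Relation.Nullary using (¬_; Dec; yes; no; contradiction)
open import Relation.Nullary.Decidable using (map′)

-- `IsCyclotomic` supplies nothing but a product identity over ℤ, so both the symmetry and the
-- degree of `Φ n` have to be drawn from it. The degree matters because β^φ(n) Φ_n(α/β) is a form in
-- α and β only if deg Φ_n is at most φ(n). The count ∑ φ(d) = n therefore serves three times: for
-- the degree of `Φ n`, for the exponent in αⁿ + βⁿ, and for the parity of φ(n).
--
-- In characteristic 2 the sign change of B is the identity and cannot detect F[B²,C]; membership is
-- shown by explicit preimages under the substitution of B² for B. The basis 1, Bα comes from the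
-- grading in which B, α, β have degree 1 and C has degree 2: the elements of even degree in F[B,C]
-- + F[B,C] α are exactly F[B²,C] + F[B²,C] Bα. The factor B thus makes the coordinates of an even
-- form lie in F[B²,C] instead of F[B,C].

private
  variable
    c ℓ c₁ ℓ₁ c₂ ℓ₂ : Level

-- Arithmetic of coefficient lists: the polynomial ring over a commutative ring

module PolynomialRing (R : CommutativeRing c ℓ) where
  open CommutativeRing R
  open RingProperties ring using (-0#≈0#)
  open Poly rawRing
  open _≋_
  open SetoidReasoning setoid

  coeff-⊕ : ∀ p q i → coeff (p ⊕ q) i ≈ coeff p i + coeff q i
  coeff-⊕ []      q       i       = sym (+-identityˡ _)
  coeff-⊕ (a ∷ p) []      i       = sym (+-identityʳ _)
  coeff-⊕ (a ∷ p) (b ∷ q) zero    = refl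
  coeff-⊕ (a ∷ p) (b ∷ q) (suc i) = coeff-⊕ p q i

  coeff-scale : ∀ a p i → coeff (map (a *_) p) i ≈ a * coeff p i
  coeff-scale a []      i       = sym (zeroʳ a)
  coeff-scale a (b ∷ p) zero    = refl
  coeff-scale a (b ∷ p) (suc i) = coeff-scale a p i

  coeff-neg : ∀ p i → coeff (map (-_) p) i ≈ - coeff p i
  coeff-neg []      i       = sym -0#≈0#
  coeff-neg (a ∷ p) zero    = refl
  coeff-neg (a ∷ p) (suc i) = coeff-neg p i

  ≋-refl : ∀ {p} → p ≋ p
  ≋-refl = mk≋ λ i → refl

  ≋-sym : ∀ {p q} → p ≋ q → q ≋ p
  ≋-sym p≋q = mk≋ λ i → sym (coeff≈ p≋q i)

  ≋-trans : ∀ {p q r} → p ≋ q → q ≋ r → p ≋ r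
  ≋-trans p≋q q≋r = mk≋ λ i → trans (coeff≈ p≋q i) (coeff≈ q≋r i)

  ∷-cong : ∀ {a b p q} → a ≈ b → p ≋ q → a ∷ p ≋ b ∷ q
  ∷-cong a≈b p≋q = mk≋ λ { zero → a≈b ; (suc i) → coeff≈ p≋q i }

  ∷-tail : ∀ {a b p q} → a ∷ p ≋ b ∷ q → p ≋ q
  ∷-tail eq = mk≋ λ i → coeff≈ eq (suc i)

  ⊕-cong : ∀ {p q r s} → p ≋ q → r ≋ s → p ⊕ r ≋ q ⊕ s
  ⊕-cong {p} {q} {r} {s} p≋q r≋s = mk≋ λ i → begin
    coeff (p ⊕ r) i       ≈⟨ coeff-⊕ p r i ⟩
    coeff p i + coeff r i ≈⟨ +-cong (coeff≈ p≋q i) (coeff≈ r≋s i) ⟩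
    coeff q i + coeff s i ≈⟨ coeff-⊕ q s i ⟨
    coeff (q ⊕ s) i       ∎

  ⊕-assoc : ∀ p q r → (p ⊕ q) ⊕ r ≋ p ⊕ (q ⊕ r)
  ⊕-assoc p q r = mk≋ λ i → begin
    coeff ((p ⊕ q) ⊕ r) i               ≈⟨ coeff-⊕ (p ⊕ q) r i ⟩
    coeff (p ⊕ q) i + coeff r i         ≈⟨ +-congʳ (coeff-⊕ p q i) ⟩
    (coeff p i + coeff q i) + coeff r i ≈⟨ +-assoc _ _ _ ⟩
    coeff p i + (coeff q i + coeff r i) ≈⟨ +-congˡ (coeff-⊕ q r i) ⟨
    coeff p i + coeff (q ⊕ r) i         ≈⟨ coeff-⊕ p (q ⊕ r) i ⟨
    coeff (p ⊕ (q ⊕ r)) i               ∎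

  ⊕-comm : ∀ p q → p ⊕ q ≋ q ⊕ p
  ⊕-comm p q = mk≋ λ i → begin
    coeff (p ⊕ q) i       ≈⟨ coeff-⊕ p q i ⟩
    coeff p i + coeff q i ≈⟨ +-comm _ _ ⟩
    coeff q i + coeff p i ≈⟨ coeff-⊕ q p i ⟨
    coeff (q ⊕ p) i       ∎

  ⊕-identityʳ : ∀ p → p ⊕ [] ≋ p
  ⊕-identityʳ p = ⊕-comm p []

  ⊕-inverseʳ : ∀ p → p ⊕ map (-_) p ≋ []
  ⊕-inverseʳ p = mk≋ λ i → begin
    coeff (p ⊕ map (-_) p) i       ≈⟨ coeff-⊕ p _ i ⟩
    coeff p i + coeff (map -_ p) i ≈⟨ +-congˡ (coeff-neg p i) ⟩
    coeff p i + - coeff p i        ≈⟨ -‿inverseʳ _ ⟩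
    0#                             ∎

  ⊕-inverseˡ : ∀ p → map (-_) p ⊕ p ≋ []
  ⊕-inverseˡ p = ≋-trans (⊕-comm (map (-_) p) p) (⊕-inverseʳ p)

  neg-cong : ∀ {p q} → p ≋ q → map (-_) p ≋ map (-_) q
  neg-cong {p} {q} p≋q = mk≋ λ i →
    trans (coeff-neg p i) (trans (-‿cong (coeff≈ p≋q i)) (sym (coeff-neg q i)))

  ⊕-interchange : ∀ p q r s → (p ⊕ q) ⊕ (r ⊕ s) ≋ (p ⊕ r) ⊕ (q ⊕ s)
  ⊕-interchange p q r s =
    ≋-trans (⊕-assoc p q (r ⊕ s))
    (≋-trans (⊕-cong (≋-refl {p})
      (≋-trans (≋-sym (⊕-assoc q r s))
      (≋-trans (⊕-cong (⊕-comm q r) (≋-refl {s})) (⊕-assoc r q s))))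
    (≋-sym (⊕-assoc p r (q ⊕ s))))

  scale-cong : ∀ {a b p q} → a ≈ b → p ≋ q → map (a *_) p ≋ map (b *_) q
  scale-cong {a} {b} {p} {q} a≈b p≋q = mk≋ λ i →
    trans (coeff-scale a p i)
      (trans (*-cong a≈b (coeff≈ p≋q i)) (sym (coeff-scale b q i)))

  scale-⊕ : ∀ a p q → map (a *_) (p ⊕ q) ≋ map (a *_) p ⊕ map (a *_) q
  scale-⊕ a p q = mk≋ λ i → begin
    coeff (map (a *_) (p ⊕ q)) i                        ≈⟨ coeff-scale a (p ⊕ q) i ⟩
    a * coeff (p ⊕ q) i                                 ≈⟨ *-congˡ (coeff-⊕ p q i) ⟩
    a * (coeff p i + coeff q i)                         ≈⟨ distribˡ _ _ _ ⟩
    a * coeff p i + a * coeff q i                       ≈⟨ +-cong (coeff-scale a p i) (coeff-scale a q i) ⟨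
    coeff (map (a *_) p) i + coeff (map (a *_) q) i     ≈⟨ coeff-⊕ (map (a *_) p) _ i ⟨
    coeff (map (a *_) p ⊕ map (a *_) q) i               ∎

  +-scale : ∀ a b p → map ((a + b) *_) p ≋ map (a *_) p ⊕ map (b *_) p
  +-scale a b p = mk≋ λ i → begin
    coeff (map ((a + b) *_) p) i                        ≈⟨ coeff-scale (a + b) p i ⟩
    (a + b) * coeff p i                                 ≈⟨ distribʳ _ _ _ ⟩
    a * coeff p i + b * coeff p i                       ≈⟨ +-cong (coeff-scale a p i) (coeff-scale b p i) ⟨
    coeff (map (a *_) p) i + coeff (map (b *_) p) i     ≈⟨ coeff-⊕ (map (a *_) p) _ i ⟨
    coeff (map (a *_) p ⊕ map (b *_) p) i               ∎

  *-scale : ∀ a b p → map ((a * b) *_) p ≋ map (a *_) (map (b *_) p)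
  *-scale a b p = mk≋ λ i → begin
    coeff (map ((a * b) *_) p) i         ≈⟨ coeff-scale (a * b) p i ⟩
    (a * b) * coeff p i                  ≈⟨ *-assoc _ _ _ ⟩
    a * (b * coeff p i)                  ≈⟨ *-congˡ (coeff-scale b p i) ⟨
    a * coeff (map (b *_) p) i           ≈⟨ coeff-scale a (map (b *_) p) i ⟨
    coeff (map (a *_) (map (b *_) p)) i  ∎

  0-scale : ∀ p → map (0# *_) p ≋ []
  0-scale p = mk≋ λ i → trans (coeff-scale 0# p i) (zeroˡ _)

  1-scale : ∀ p → map (1# *_) p ≋ p
  1-scale p = mk≋ λ i → trans (coeff-scale 1# p i) (*-identityˡ _)

  0∷[]≋[] : 0# ∷ [] ≋ []
  0∷[]≋[] = mk≋ λ { zero → refl ; (suc i) → refl }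

  -- A nonempty list of zeros also represents the zero polynomial; congruence of the product has to
  -- compare such a list with `[]`.
  ≋[]⇒⊗≋[] : ∀ {p} q → p ≋ [] → p ⊗ q ≋ []
  ≋[]⇒⊗≋[] {[]}    q p≋[] = ≋-refl
  ≋[]⇒⊗≋[] {a ∷ p} q p≋[] =
    ⊕-cong {q = []}
      (≋-trans (scale-cong {q = q} (coeff≈ p≋[] 0) ≋-refl) (0-scale q))
      (≋-trans (∷-cong refl (≋[]⇒⊗≋[] {p} q (mk≋ λ i → coeff≈ p≋[] (suc i)))) 0∷[]≋[])

  ⊗-congʳ : ∀ {p q} r → p ≋ q → p ⊗ r ≋ q ⊗ r
  ⊗-congʳ {[]}    {q}     r p≋q = ≋-sym (≋[]⇒⊗≋[] r (≋-sym p≋q))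
  ⊗-congʳ {a ∷ p} {[]}    r p≋q = ≋[]⇒⊗≋[] r p≋q
  ⊗-congʳ {a ∷ p} {b ∷ q} r p≋q =
    ⊕-cong (scale-cong {p = r} (coeff≈ p≋q 0) ≋-refl) (∷-cong refl (⊗-congʳ r (∷-tail p≋q)))

  ⊗-congˡ : ∀ p {q r} → q ≋ r → p ⊗ q ≋ p ⊗ r
  ⊗-congˡ []      q≋r = ≋-refl
  ⊗-congˡ (a ∷ p) q≋r = ⊕-cong (scale-cong refl q≋r) (∷-cong refl (⊗-congˡ p q≋r))

  ⊗-cong : ∀ {p q r s} → p ≋ q → r ≋ s → p ⊗ r ≋ q ⊗ s
  ⊗-cong {q = q} {r} p≋q r≋s = ≋-trans (⊗-congʳ r p≋q) (⊗-congˡ q r≋s)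

  ⊗-zeroʳ : ∀ p → p ⊗ [] ≋ []
  ⊗-zeroʳ []      = ≋-refl
  ⊗-zeroʳ (a ∷ p) = ≋-trans (∷-cong refl (⊗-zeroʳ p)) 0∷[]≋[]

  ⊗-distribʳ : ∀ r p q → (p ⊕ q) ⊗ r ≋ (p ⊗ r) ⊕ (q ⊗ r)
  ⊗-distribʳ r []      q       = ≋-refl
  ⊗-distribʳ r (a ∷ p) []      = ≋-sym (⊕-identityʳ _)
  ⊗-distribʳ r (a ∷ p) (b ∷ q) =
    ≋-trans
      (⊕-cong (+-scale a b r) (∷-cong (sym (+-identityˡ 0#)) (⊗-distribʳ r p q)))
      (⊕-interchange (map (a *_) r) (map (b *_) r) (0# ∷ p ⊗ r) (0# ∷ q ⊗ r))

  -- The product is defined by recursion on its first factor. This mirror image of the defining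
  -- clause is what the induction for commutativity needs.
  ⊗-∷ʳ : ∀ p b q → p ⊗ (b ∷ q) ≋ map (b *_) p ⊕ (0# ∷ p ⊗ q)
  ⊗-∷ʳ []      b q = ≋-sym 0∷[]≋[]
  ⊗-∷ʳ (a ∷ p) b q = ∷-cong (+-congʳ (*-comm a b))
    (≋-trans (⊕-cong (≋-refl {map (a *_) q}) (⊗-∷ʳ p b q))
    (≋-trans (≋-sym (⊕-assoc (map (a *_) q) (map (b *_) p) _))
    (≋-trans (⊕-cong (⊕-comm (map (a *_) q) (map (b *_) p)) ≋-refl)
             (⊕-assoc (map (b *_) p) (map (a *_) q) _))))

  ⊗-comm : ∀ p q → p ⊗ q ≋ q ⊗ p
  ⊗-comm []      q = ≋-sym (⊗-zeroʳ q)
  ⊗-comm (a ∷ p) q =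
    ≋-trans (⊕-cong (≋-refl {map (a *_) q}) (∷-cong refl (⊗-comm p q))) (≋-sym (⊗-∷ʳ q a p))

  ⊗-distribˡ : ∀ p q r → p ⊗ (q ⊕ r) ≋ (p ⊗ q) ⊕ (p ⊗ r)
  ⊗-distribˡ p q r =
    ≋-trans (⊗-comm p (q ⊕ r))
    (≋-trans (⊗-distribʳ p q r) (⊕-cong (⊗-comm q p) (⊗-comm r p)))

  scale-⊗ : ∀ a p q → map (a *_) p ⊗ q ≋ map (a *_) (p ⊗ q)
  scale-⊗ a []      q = ≋-refl
  scale-⊗ a (b ∷ p) q =
    ≋-trans (⊕-cong (*-scale a b q) (∷-cong (sym (zeroʳ a)) (scale-⊗ a p q)))
            (≋-sym (scale-⊕ a (map (b *_) q) (0# ∷ p ⊗ q)))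

  0∷-⊗ : ∀ p q → (0# ∷ p) ⊗ q ≋ 0# ∷ (p ⊗ q)
  0∷-⊗ p q = ⊕-cong (0-scale q) ≋-refl

  ⊗-assoc : ∀ p q r → (p ⊗ q) ⊗ r ≋ p ⊗ (q ⊗ r)
  ⊗-assoc []      q r = ≋-refl
  ⊗-assoc (a ∷ p) q r =
    ≋-trans (⊗-distribʳ r (map (a *_) q) (0# ∷ p ⊗ q))
      (⊕-cong (scale-⊗ a q r)
              (≋-trans (0∷-⊗ (p ⊗ q) r) (∷-cong refl (⊗-assoc p q r))))

  ⊗-identityˡ : ∀ p → (1# ∷ []) ⊗ p ≋ p
  ⊗-identityˡ p = ≋-trans (⊕-cong (1-scale p) 0∷[]≋[]) (⊕-identityʳ p)

  ⊗-identityʳ : ∀ p → p ⊗ (1# ∷ []) ≋ p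
  ⊗-identityʳ p = ≋-trans (⊗-comm p _) (⊗-identityˡ p)

  polynomialRing : CommutativeRing c ℓ
  polynomialRing = record
    { Carrier = List Carrier
    ; _≈_     = _≋_
    ; _+_     = _⊕_
    ; _*_     = _⊗_
    ; -_      = map (-_)
    ; 0#      = []
    ; 1#      = 1# ∷ []
    ; isCommutativeRing = record
      { isRing = record
        { +-isAbelianGroup = record
          { isGroup = record
            { isMonoid = record
              { isSemigroup = record
                { isMagma = record
                  { isEquivalence = record { refl = ≋-refl ; sym = ≋-sym ; trans = ≋-trans }
                  ; ∙-cong = ⊕-cong
                  }
                ; assoc = ⊕-assoc
                }
              ; identity = (λ p → ≋-refl) , ⊕-identityʳ
              }
            ; inverse = ⊕-inverseˡ , ⊕-inverseʳ
            ; ⁻¹-cong = neg-cong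
            }
          ; comm = ⊕-comm
          }
        ; *-cong     = ⊗-cong
        ; *-assoc    = ⊗-assoc
        ; *-identity = ⊗-identityˡ , ⊗-identityʳ
        ; distrib    = ⊗-distribˡ , ⊗-distribʳ
        }
      ; *-comm = ⊗-comm
      }
    }

-- Ring homomorphisms and evaluation of polynomials

IsHomomorphism : (R : CommutativeRing c₁ ℓ₁) (S : CommutativeRing c₂ ℓ₂) →
                 (CommutativeRing.Carrier R → CommutativeRing.Carrier S) → Set _
IsHomomorphism R S =
  RingMorphisms.IsRingHomomorphism (CommutativeRing.rawRing R) (CommutativeRing.rawRing S)

-- Preservation of negation follows from additivity.
mkHomomorphism : (R : CommutativeRing c₁ ℓ₁) (S : CommutativeRing c₂ ℓ₂) →
  let module R = CommutativeRing R
      module S = CommutativeRing S in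
  {f : R.Carrier → S.Carrier} →
  (∀ {x y} → x R.≈ y → f x S.≈ f y) →
  (∀ x y → f (x R.+ y) S.≈ f x S.+ f y) → f R.0# S.≈ S.0# →
  (∀ x y → f (x R.* y) S.≈ f x S.* f y) → f R.1# S.≈ S.1# →
  IsHomomorphism R S f
mkHomomorphism R S {f} cong +-homo 0#-homo *-homo 1#-homo = record
  { isSemiringHomomorphism = record
    { isNearSemiringHomomorphism = record
      { +-isMonoidHomomorphism = record
        { isMagmaHomomorphism = record
          { isRelHomomorphism = record { cong = cong } ; homo = +-homo }
        ; ε-homo = 0#-homo
        }
      ; *-homo = *-homo
      }
    ; 1#-homo = 1#-homo
    }
  ; -‿homo = λ x → inverseˡ-unique _ _
      (trans (sym (+-homo (R.- x) x)) (trans (cong (R.-‿inverseˡ x)) 0#-homo))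
  }
  where
  module R = CommutativeRing R
  open CommutativeRing S using (ring; sym; trans)
  open RingProperties ring renaming (+-inverseˡ-unique to inverseˡ-unique)

module Evaluation (R : CommutativeRing c₁ ℓ₁) (S : CommutativeRing c₂ ℓ₂)
                  {f : CommutativeRing.Carrier R → CommutativeRing.Carrier S}
                  (f-homo : IsHomomorphism R S f)
                  (s : CommutativeRing.Carrier S) where
  private
    module R = CommutativeRing R
    module f = RingMorphisms.IsRingHomomorphism f-homo
  open CommutativeRing S
  open Poly R.rawRing
  open _≋_
  open PolynomialRing R using (∷-tail)
  open SetoidReasoning setoid

  evalₛ : List R.Carrier → Carrier
  evalₛ = eval₂ R.rawRing rawRing f s

  evalₛ-[] : ∀ p → p ≋ [] → evalₛ p ≈ 0#
  evalₛ-[] []      p≋[] = refl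
  evalₛ-[] (a ∷ p) p≋[] = begin
    f a + s * evalₛ p ≈⟨ +-cong (f.⟦⟧-cong (coeff≈ p≋[] 0))
                               (*-congˡ (evalₛ-[] p (mk≋ λ i → coeff≈ p≋[] (suc i)))) ⟩
    f R.0# + s * 0#   ≈⟨ +-cong f.0#-homo (zeroʳ s) ⟩
    0# + 0#           ≈⟨ +-identityˡ 0# ⟩
    0#                ∎

  evalₛ-cong : ∀ {p q} → p ≋ q → evalₛ p ≈ evalₛ q
  evalₛ-cong {[]}    {q}     p≋q = sym (evalₛ-[] q (mk≋ λ i → R.sym (coeff≈ p≋q i)))
  evalₛ-cong {a ∷ p} {[]}    p≋q = evalₛ-[] (a ∷ p) p≋q
  evalₛ-cong {a ∷ p} {b ∷ q} p≋q =
    +-cong (f.⟦⟧-cong (coeff≈ p≋q 0)) (*-congˡ (evalₛ-cong (∷-tail p≋q)))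

  evalₛ-⊕ : ∀ p q → evalₛ (p ⊕ q) ≈ evalₛ p + evalₛ q
  evalₛ-⊕ []      q       = sym (+-identityˡ _)
  evalₛ-⊕ (a ∷ p) []      = sym (+-identityʳ _)
  evalₛ-⊕ (a ∷ p) (b ∷ q) = begin
    f (a R.+ b) + s * evalₛ (p ⊕ q)             ≈⟨ +-cong (f.+-homo a b) (*-congˡ (evalₛ-⊕ p q)) ⟩
    (f a + f b) + s * (evalₛ p + evalₛ q)       ≈⟨ +-congˡ (distribˡ _ _ _) ⟩
    (f a + f b) + (s * evalₛ p + s * evalₛ q)   ≈⟨ interchange +-commutativeSemigroup _ _ _ _ ⟩
    (f a + s * evalₛ p) + (f b + s * evalₛ q)   ∎

  evalₛ-scale : ∀ a p → evalₛ (map (a R.*_) p) ≈ f a * evalₛ p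
  evalₛ-scale a []      = sym (zeroʳ _)
  evalₛ-scale a (b ∷ p) = begin
    f (a R.* b) + s * evalₛ (map (a R.*_) p) ≈⟨ +-cong (f.*-homo a b) (*-congˡ (evalₛ-scale a p)) ⟩
    f a * f b + s * (f a * evalₛ p)          ≈⟨ +-congˡ (trans (sym (*-assoc _ _ _))
                                                 (trans (*-congʳ (*-comm _ _)) (*-assoc _ _ _))) ⟩
    f a * f b + f a * (s * evalₛ p)          ≈⟨ distribˡ _ _ _ ⟨
    f a * (f b + s * evalₛ p)                ∎

  evalₛ-⊗ : ∀ p q → evalₛ (p ⊗ q) ≈ evalₛ p * evalₛ q
  evalₛ-⊗ []      q = sym (zeroˡ _)
  evalₛ-⊗ (a ∷ p) q = begin
    evalₛ (map (a R.*_) q ⊕ (R.0# ∷ p ⊗ q))                ≈⟨ evalₛ-⊕ (map (a R.*_) q) _ ⟩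
    evalₛ (map (a R.*_) q) + (f R.0# + s * evalₛ (p ⊗ q))  ≈⟨ +-cong (evalₛ-scale a q)
      (trans (+-congʳ f.0#-homo) (trans (+-identityˡ _)
        (trans (*-congˡ (evalₛ-⊗ p q)) (sym (*-assoc _ _ _))))) ⟩
    f a * evalₛ q + (s * evalₛ p) * evalₛ q                ≈⟨ distribʳ _ _ _ ⟨
    (f a + s * evalₛ p) * evalₛ q                          ∎

  evalₛ-const : ∀ a → evalₛ (const a) ≈ f a
  evalₛ-const a = trans (+-congˡ (zeroʳ s)) (+-identityʳ _)

  evalₛ-X : evalₛ X ≈ s
  evalₛ-X = begin
    f R.0# + s * evalₛ (const R.1#) ≈⟨ +-cong f.0#-homo (*-congˡ (trans (evalₛ-const R.1#) f.1#-homo)) ⟩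
    0# + s * 1#                     ≈⟨ +-identityˡ _ ⟩
    s * 1#                          ≈⟨ *-identityʳ s ⟩
    s                               ∎

  evalₛ-homo : IsHomomorphism (PolynomialRing.polynomialRing R) S evalₛ
  evalₛ-homo = mkHomomorphism (PolynomialRing.polynomialRing R) S evalₛ-cong evalₛ-⊕ refl evalₛ-⊗
    (trans (evalₛ-const R.1#) f.1#-homo)

const-homo : (R : CommutativeRing c ℓ) →
             IsHomomorphism R (PolynomialRing.polynomialRing R) (Poly.const (CommutativeRing.rawRing R))
const-homo R = mkHomomorphism R polynomialRing
  (λ a≈b → ∷-cong a≈b ≋-refl) (λ a b → ≋-refl) 0∷[]≋[]
  (λ a b → ∷-cong (sym (+-identityʳ _)) ≋-refl) ≋-refl
  where
  open CommutativeRing R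
  open PolynomialRing R

-- Degrees of polynomials

module Degree (R : CommutativeRing c ℓ) where
  open CommutativeRing R
  open Poly rawRing
  open _≋_
  open PolynomialRing R
  open SetoidReasoning setoid

  Degree≤ : List Carrier → ℕ → Set ℓ
  Degree≤ p d = ∀ i → d < i → coeff p i ≈ 0#

  -- Trailing zeros make the length of a list useless as a degree, hence a relation; the zero
  -- polynomial has no degree at all.
  record HasDegree (p : List Carrier) (d : ℕ) : Set ℓ where
    constructor _,_
    field
      leading≉0 : ¬ (coeff p d ≈ 0#)
      degree≤   : Degree≤ p d

  open HasDegree public

  degree-unique : ∀ {p d e} → HasDegree p d → HasDegree p e → d ≡ e
  degree-unique {d = d} {e} hd he with ℕ.<-cmp d e
  ... | tri< d<e _ _ = contradiction (degree≤ hd e d<e) (leading≉0 he)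
  ... | tri≈ _ d≡e _ = d≡e
  ... | tri> _ _ e<d = contradiction (degree≤ he d e<d) (leading≉0 hd)

  degree-cong : ∀ {p q d} → p ≋ q → HasDegree p d → HasDegree q d
  degree-cong {d = d} p≋q hd =
    (λ eq → leading≉0 hd (trans (coeff≈ p≋q d) eq)) ,
    (λ i d<i → trans (sym (coeff≈ p≋q i)) (degree≤ hd i d<i))

  -- Both inductions lower the bound `d` along with the list `p`. At `d = 0` the tail of `p` is a
  -- list of zeros, and only the multiple of `q` by the head survives.
  Degree≤-⊗ : ∀ p q {d e} → Degree≤ p d → Degree≤ q e → Degree≤ (p ⊗ q) (d +ℕ e)
  coeff-⊗   : ∀ p q {d e} → Degree≤ p d → Degree≤ q e →
              coeff (p ⊗ q) (d +ℕ e) ≈ coeff p d * coeff q e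

  Degree≤-⊗ [] q hp hq i d+e<i = refl
  Degree≤-⊗ (a ∷ p) q {zero} {e} hp hq i e<i = begin
    coeff (map (a *_) q ⊕ (0# ∷ p ⊗ q)) i        ≈⟨ coeff-⊕ (map (a *_) q) _ i ⟩
    coeff (map (a *_) q) i + coeff (0# ∷ p ⊗ q) i ≈⟨ +-cong (trans (coeff-scale a q i) (*-congˡ (hq i e<i)))
      (coeff≈ (≋-trans (∷-cong refl (≋[]⇒⊗≋[] {p} q (mk≋ λ k → hp (suc k) z<s))) 0∷[]≋[]) i) ⟩
    a * 0# + 0# ≈⟨ trans (+-identityʳ _) (zeroʳ a) ⟩
    0# ∎
  Degree≤-⊗ (a ∷ p) q {suc d} {e} hp hq (suc i) (s≤s d+e<i) = begin
    coeff (map (a *_) q ⊕ (0# ∷ p ⊗ q)) (suc i)   ≈⟨ coeff-⊕ (map (a *_) q) _ (suc i) ⟩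
    coeff (map (a *_) q) (suc i) + coeff (p ⊗ q) i ≈⟨ +-cong
      (trans (coeff-scale a q (suc i)) (*-congˡ (hq (suc i) (ℕ.≤-<-trans (ℕ.m≤n+m e (suc d)) (s≤s d+e<i)))))
      (Degree≤-⊗ p q (λ k d<k → hp (suc k) (s≤s d<k)) hq i d+e<i) ⟩
    a * 0# + 0# ≈⟨ trans (+-identityʳ _) (zeroʳ a) ⟩
    0# ∎

  coeff-⊗ [] q hp hq = sym (zeroˡ _)
  coeff-⊗ (a ∷ p) q {zero} {e} hp hq = begin
    coeff (map (a *_) q ⊕ (0# ∷ p ⊗ q)) e         ≈⟨ coeff-⊕ (map (a *_) q) _ e ⟩
    coeff (map (a *_) q) e + coeff (0# ∷ p ⊗ q) e ≈⟨ +-cong (coeff-scale a q e)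
      (coeff≈ (≋-trans (∷-cong refl (≋[]⇒⊗≋[] {p} q (mk≋ λ k → hp (suc k) z<s))) 0∷[]≋[]) e) ⟩
    a * coeff q e + 0#                            ≈⟨ +-identityʳ _ ⟩
    a * coeff q e                                 ∎
  coeff-⊗ (a ∷ p) q {suc d} {e} hp hq = begin
    coeff (map (a *_) q ⊕ (0# ∷ p ⊗ q)) (suc (d +ℕ e)) ≈⟨ coeff-⊕ (map (a *_) q) _ (suc (d +ℕ e)) ⟩
    coeff (map (a *_) q) (suc (d +ℕ e)) + coeff (p ⊗ q) (d +ℕ e)
      ≈⟨ +-cong (trans (coeff-scale a q (suc (d +ℕ e))) (*-congˡ (hq _ (s≤s (ℕ.m≤n+m e d)))))
                (coeff-⊗ p q (λ k d<k → hp (suc k) (s≤s d<k)) hq) ⟩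
    a * 0# + coeff p d * coeff q e ≈⟨ trans (+-congʳ (zeroʳ a)) (+-identityˡ _) ⟩
    coeff p d * coeff q e ∎

  module _ (integral : ∀ {x y} → x * y ≈ 0# → x ≈ 0# ⊎ y ≈ 0#) where

    degree-⊗ : ∀ p q {d e} → HasDegree p d → HasDegree q e → HasDegree (p ⊗ q) (d +ℕ e)
    degree-⊗ p q hp hq =
      (λ eq → case integral (trans (sym (coeff-⊗ p q (degree≤ hp) (degree≤ hq))) eq) of λ
        { (inj₁ x≈0) → leading≉0 hp x≈0
        ; (inj₂ y≈0) → leading≉0 hq y≈0 }) ,
      Degree≤-⊗ p q (degree≤ hp) (degree≤ hq)

  module _ (zero? : ∀ x → Dec (x ≈ 0#)) where

    -- The list is searched from its end for the last nonzero entry, which takes a decision at each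
    -- coefficient.
    ≋[]-or-degree : ∀ p → p ≋ [] ⊎ ∃[ d ] HasDegree p d
    ≋[]-or-degree [] = inj₁ ≋-refl
    ≋[]-or-degree (a ∷ p) with ≋[]-or-degree p
    ... | inj₂ (d , hd) = inj₂ (suc d , (leading≉0 hd , λ { (suc i) (s≤s d<i) → degree≤ hd i d<i }))
    ... | inj₁ p≋[] with zero? a
    ...   | yes a≈0 = inj₁ (≋-trans (∷-cong a≈0 p≋[]) 0∷[]≋[])
    ...   | no  a≉0 = inj₂ (0 , (a≉0 , λ { (suc i) _ → coeff≈ p≋[] i }))

-- Divisor sums and parity of Euler's totient

module Totient where
  open import Data.List.Base using (filter; length; applyUpTo; concat)
  open import Data.List.Membership.Propositional using (_∈_)
  open import Data.List.Membership.Propositional.Properties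
    using (∈-filter⁺; ∈-filter⁻; ∈-applyUpTo⁺; ∈-applyUpTo⁻; ∈-map⁺; ∈-map⁻; ∈-concat⁺′; ∈-concat⁻′)
  open import Data.List.Membership.Propositional.Properties.WithK using (unique∧set⇒bag)
  open import Data.List.Properties
    using (length-map; length-applyUpTo; length-++; filter-++; filter-accept; applyUpTo-∷ʳ;
           map-++; map-∘; map-cong-local)
  open import Data.List.Relation.Binary.BagAndSetEquality using (∼bag⇒↭)
  open import Data.List.Relation.Binary.Permutation.Propositional.Properties using (↭-length)
  import Data.List.Relation.Unary.All.Properties as All
  import Data.List.Relation.Unary.AllPairs as AllPairs
  import Data.List.Relation.Unary.AllPairs.Properties as AllPairs
  open import Data.List.Relation.Unary.Unique.Propositional using (Unique)
  open import Data.List.Relation.Unary.Unique.Propositional.Properties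
    using (concat⁺)
    renaming (map⁺ to unique-map⁺; filter⁺ to unique-filter⁺; applyUpTo⁺₁ to unique-applyUpTo⁺)
  open import Data.Nat.Base using (_+_; _*_; >-nonZero⁻¹; ≢-nonZero; ≢-nonZero⁻¹)
  open import Data.Nat.Coprimality using (coprime?; coprime⇒gcd≡1; gcd≡1⇒coprime)
  open import Data.Nat.Divisibility using (_∣?_; divides-refl; ∣⇒≤; 1∣_; ∣-refl; ∣m∣n⇒∣m+n)
  open import Data.Nat.GCD using (gcd; gcd[m,n]∣m; gcd[m,n]∣n; c*gcd[m,n]≡gcd[cm,cn])
  open import Data.Nat.ListAction.Properties using (sum-++)
  open import Data.Nat.Properties
    using (_≟_; *-cancelˡ-≡; *-cancelʳ-≡; *-cancelʳ-≤; *-comm; *-monoˡ-≤; *-identityʳ; m*n≢0;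
           suc-injective; <⇒≢; +-identityʳ; +-suc)
  open import Function.Bundles using (mk⇔)
  open import Relation.Binary.PropositionalEquality
    using (refl; sym; trans; cong; cong₂; subst; _≢_; module ≡-Reasoning)
  open import Relation.Unary using (Pred; Decidable)

  private
    variable
      n d : ℕ

  divisors : ℕ → List ℕ
  divisors n = filter (_∣? n) (applyUpTo suc n)

  properDivisors : ℕ → List ℕ
  properDivisors zero    = []
  properDivisors (suc n) = filter (_∣? suc n) (applyUpTo suc n)

  divisors≡properDivisors++ : ∀ n .{{_ : NonZero n}} → divisors n ≡ properDivisors n ++ [ n ]
  divisors≡properDivisors++ (suc n) = begin
    filter (_∣? suc n) (applyUpTo suc (suc n))
      ≡⟨ cong (filter (_∣? suc n)) (applyUpTo-∷ʳ suc n) ⟨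
    filter (_∣? suc n) (applyUpTo suc n ++ [ suc n ])
      ≡⟨ filter-++ (_∣? suc n) (applyUpTo suc n) [ suc n ] ⟩
    properDivisors (suc n) ++ filter (_∣? suc n) [ suc n ]
      ≡⟨ cong (properDivisors (suc n) ++_) (filter-accept (_∣? suc n) ∣-refl) ⟩
    properDivisors (suc n) ++ [ suc n ] ∎
    where open ≡-Reasoning

  ∈-range⁺ : ∀ n {m} → 1 ≤ m → m ≤ n → m ∈ applyUpTo suc n
  ∈-range⁺ n (s≤s z≤n) m≤n = ∈-applyUpTo⁺ suc m≤n

  ∈-range⁻ : ∀ n {m} → m ∈ applyUpTo suc n → 1 ≤ m × m ≤ n
  ∈-range⁻ n m∈ with ∈-applyUpTo⁻ suc {n = n} m∈
  ... | i , i<n , refl = z<s , i<n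

  module _ {p} {P : Pred ℕ p} (P? : Decidable P) (n : ℕ) where

    ∈-filter-range⁺ : ∀ {m} → 1 ≤ m → m ≤ n → P m → m ∈ filter P? (applyUpTo suc n)
    ∈-filter-range⁺ 1≤m m≤n = ∈-filter⁺ P? (∈-range⁺ n 1≤m m≤n)

    ∈-filter-range⁻ : ∀ {m} → m ∈ filter P? (applyUpTo suc n) → 1 ≤ m × m ≤ n × P m
    ∈-filter-range⁻ m∈ with ∈-filter⁻ P? {xs = applyUpTo suc n} m∈
    ... | m∈range , Pm with ∈-range⁻ n m∈range
    ...   | 1≤m , m≤n = 1≤m , m≤n , Pm

  ∈-properDivisors : d ∈ properDivisors n → 1 ≤ d × d < n × d ∣ n
  ∈-properDivisors {n = suc n} d∈ with ∈-filter-range⁻ (_∣? suc n) n d∈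
  ... | 1≤d , d≤n , d∣n = 1≤d , s≤s d≤n , d∣n

  unique-range : ∀ n → Unique (applyUpTo suc n)
  unique-range n = unique-applyUpTo⁺ suc n λ i<j _ → <⇒≢ i<j ∘ suc-injective

  -- Duplicate-free lists with the same members are permutations of each other, so a count reduces
  -- to two inclusions.
  length-set-≡ : ∀ {a} {A : Set a} {xs ys : List A} → Unique xs → Unique ys →
                 (∀ {x} → x ∈ xs → x ∈ ys) → (∀ {x} → x ∈ ys → x ∈ xs) → length xs ≡ length ys
  length-set-≡ xs! ys! xs⊆ys ys⊆xs =
    ↭-length (∼bag⇒↭ (unique∧set⇒bag xs! ys! (mk⇔ xs⊆ys ys⊆xs)))

  length-concat : ∀ {a} {A : Set a} (xss : List (List A)) → length (concat xss) ≡ sum (map length xss)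
  length-concat []         = refl
  length-concat (xs ∷ xss) = trans (length-++ xs) (cong (length xs +_) (length-concat xss))

  -- For d ∣ n, division by n / d maps this fibre onto the k ≤ d coprime to d.
  gcdFibre : ℕ → ℕ → List ℕ
  gcdFibre n d = filter (λ m → n ≟ d * gcd m n) (applyUpTo suc n)

  gcd-scale : ∀ q k d → gcd (k * q) (d * q) ≡ q * gcd k d
  gcd-scale q k d =
    trans (cong₂ gcd (*-comm k q) (*-comm d q)) (sym (c*gcd[m,n]≡gcd[cm,cn] q k d))

  -- For n = q d, the condition n = d gcd(m, n) says gcd(m, n) = q. Then m = k q with k at most d,
  -- and gcd(k q, d q) = q gcd(k, d) turns the condition into coprimality of k and d.
  length-gcdFibre : .{{_ : NonZero n}} → d ∣ n → length (gcdFibre n d) ≡ φ d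
  length-gcdFibre {n} {d} (divides q refl) = begin
    length (gcdFibre (q * d) d)     ≡⟨ length-set-≡
      (unique-filter⁺ _ (unique-range (q * d)))
      (unique-map⁺ (*-cancelʳ-≡ _ _ q) (unique-filter⁺ _ (unique-range d)))
      to from ⟩
    length (map (_* q) totatives)   ≡⟨ length-map (_* q) totatives ⟩
    φ d                             ∎
    where
    open ≡-Reasoning
    totatives = filter (λ k → coprime? k d) (applyUpTo suc d)
    instance
      q≢0 : NonZero q
      q≢0 = ≢-nonZero λ { refl → ≢-nonZero⁻¹ (0 * d) refl }
      d≢0 : NonZero d
      d≢0 = ≢-nonZero λ { refl → ≢-nonZero⁻¹ (q * 0) (*-comm q 0) }

    gcd-*ʳ : ∀ k → gcd (k * q) (q * d) ≡ q * gcd k d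
    gcd-*ʳ k = trans (cong (gcd (k * q)) (*-comm q d)) (gcd-scale q k d)

    to : ∀ {m} → m ∈ gcdFibre (q * d) d → m ∈ map (_* q) totatives
    to {m} m∈ with ∈-filter-range⁻ (λ m → q * d ≟ d * gcd m (q * d)) (q * d) m∈
    ... | 1≤m , m≤n , n≡d*g
        with q≡g ← *-cancelˡ-≡ q (gcd m (q * d)) d (trans (*-comm d q) n≡d*g)
        with subst (_∣ m) (sym q≡g) (gcd[m,n]∣m m (q * d))
    ...   | divides k refl =
      ∈-map⁺ (_* q) (∈-filter-range⁺ (λ k → coprime? k d) d
        (>-nonZero⁻¹ k {{≢-nonZero λ { refl → contradiction 1≤m λ () }}})
        (*-cancelʳ-≤ k d q (subst (k * q ≤_) (*-comm q d) m≤n))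
        (gcd≡1⇒coprime (*-cancelˡ-≡ (gcd k d) 1 q
          (trans (sym (gcd-*ʳ k)) (trans (sym q≡g) (sym (*-identityʳ q)))))))

    from : ∀ {m} → m ∈ map (_* q) totatives → m ∈ gcdFibre (q * d) d
    from m∈ with ∈-map⁻ (_* q) m∈
    ... | k , k∈ , refl with ∈-filter-range⁻ (λ k → coprime? k d) d k∈
    ...   | 1≤k , k≤d , k⊥d =
      ∈-filter-range⁺ (λ m → q * d ≟ d * gcd m (q * d)) (q * d)
        (>-nonZero⁻¹ (k * q) {{m*n≢0 k q {{>-nonZero 1≤k}}}})
        (subst (k * q ≤_) (*-comm d q) (*-monoˡ-≤ q k≤d))
        (trans (*-comm q d) (cong (d *_)
          (sym (trans (gcd-*ʳ k) (trans (cong (q *_) (coprime⇒gcd≡1 k⊥d)) (*-identityʳ q))))))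

  -- Gauss's count: the numbers 1, ..., n are sorted by the cofactor d of gcd(m, n) in n, and the
  -- fibre over d has φ(d) members.
  ∑φ≡n : ∀ n .{{_ : NonZero n}} → sum (map φ (divisors n)) ≡ n
  ∑φ≡n n = begin
    sum (map φ (divisors n))                       ≡⟨ cong sum (map-cong-local (All.tabulate λ d∈ →
      length-gcdFibre (proj₂ (proj₂ (∈-filter-range⁻ (_∣? n) n d∈))))) ⟨
    sum (map (length ∘ gcdFibre n) (divisors n))   ≡⟨ cong sum (map-∘ (divisors n)) ⟩
    sum (map length (map (gcdFibre n) (divisors n))) ≡⟨ length-concat (map (gcdFibre n) (divisors n)) ⟨
    length (concat (map (gcdFibre n) (divisors n))) ≡⟨ length-set-≡ unique (unique-range n) to from ⟩
    length (applyUpTo suc n)                       ≡⟨ length-applyUpTo suc n ⟩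
    n                                              ∎
    where
    open ≡-Reasoning

    unique : Unique (concat (map (gcdFibre n) (divisors n)))
    unique = concat⁺
      (All.map⁺ (All.universal (λ d → unique-filter⁺ _ (unique-range n)) (divisors n)))
      (AllPairs.map⁺ (AllPairs.map disjoint (unique-filter⁺ (_∣? n) (unique-range n))))
      where
      disjoint : ∀ {d e} → d ≢ e → ∀ {m} → ¬ (m ∈ gcdFibre n d × m ∈ gcdFibre n e)
      -- A common member m gives d gcd(m, n) = n = e gcd(m, n), and the gcd can be cancelled because
      -- n is nonzero.
      disjoint {d} {e} d≢e {m} (m∈d , m∈e) = d≢e (*-cancelʳ-≡ d e (gcd m n)
        {{≢-nonZero λ g≡0 → ≢-nonZero⁻¹ n (trans n≡d*g (trans (cong (d *_) g≡0) (*-comm d 0)))}}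
        (trans (sym n≡d*g) (proj₂ (proj₂ (∈-filter-range⁻ (λ m → n ≟ e * gcd m n) n m∈e)))))
        where n≡d*g = proj₂ (proj₂ (∈-filter-range⁻ (λ m → n ≟ d * gcd m n) n m∈d))

    to : ∀ {m} → m ∈ concat (map (gcdFibre n) (divisors n)) → m ∈ applyUpTo suc n
    to m∈ with ∈-concat⁻′ (map (gcdFibre n) (divisors n)) m∈
    ... | _ , m∈xs , xs∈ with ∈-map⁻ (gcdFibre n) xs∈
    ...   | d , _ , refl = proj₁ (∈-filter⁻ (λ m → n ≟ d * gcd m n) {xs = applyUpTo suc n} m∈xs)

    from : ∀ {m} → m ∈ applyUpTo suc n → m ∈ concat (map (gcdFibre n) (divisors n))
    from {m} m∈ with gcd[m,n]∣n m n
    ... | divides d n≡d*g =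
      ∈-concat⁺′ (∈-filter⁺ (λ m → n ≟ d * gcd m n) m∈ n≡d*g)
        (∈-map⁺ (gcdFibre n) (∈-filter-range⁺ (_∣? n) n
          (>-nonZero⁻¹ d {{≢-nonZero λ { refl → ≢-nonZero⁻¹ n n≡d*g }}}) (∣⇒≤ d∣n) d∣n))
      where
      d∣n : d ∣ n
      d∣n = divides (gcd m n) (trans n≡d*g (*-comm d (gcd m n)))

  ∑φ-properDivisors : ∀ n .{{_ : NonZero n}} → sum (map φ (properDivisors n)) + φ n ≡ n
  ∑φ-properDivisors n = begin
    sum (map φ (properDivisors n)) + φ n            ≡⟨ cong (sum (map φ (properDivisors n)) +_) (+-identityʳ (φ n)) ⟨
    sum (map φ (properDivisors n)) + sum [ φ n ]    ≡⟨ sum-++ (map φ (properDivisors n)) [ φ n ] ⟨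
    sum (map φ (properDivisors n) ++ [ φ n ])       ≡⟨ cong sum (map-++ φ (properDivisors n) [ n ]) ⟨
    sum (map φ (properDivisors n ++ [ n ]))         ≡⟨ cong (sum ∘ map φ) (divisors≡properDivisors++ n) ⟨
    sum (map φ (divisors n))                        ≡⟨ ∑φ≡n n ⟩
    n                                               ∎
    where open ≡-Reasoning

  2∣n⊎2∣1+n : ∀ n → (2 ∣ n) ⊎ (2 ∣ suc n)
  2∣n⊎2∣1+n zero    = inj₁ (divides-refl 0)
  2∣n⊎2∣1+n (suc n) with 2∣n⊎2∣1+n n
  ... | inj₁ 2∣n   = inj₂ (∣m∣n⇒∣m+n (∣-refl {2}) 2∣n)
  ... | inj₂ 2∣1+n = inj₁ 2∣1+n

  ∣sum : ∀ k {xs} → All (k ∣_) xs → k ∣ sum xs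
  ∣sum k []           = divides-refl 0
  ∣sum k (k∣x ∷ k∣xs) = ∣m∣n⇒∣m+n k∣x (∣sum k k∣xs)

  -- In ∑_{d ∣ n} φ d = n, the term φ 1 = 1 is odd and inductively every other
  -- proper divisor contributes an even term.
  2∣φ : ∀ n → ¬ (2 ∣ n) → 1 < n → 2 ∣ φ n
  2∣φ = <-rec _ step
    where
    step : ∀ n → (∀ {d} → d < n → ¬ (2 ∣ d) → 1 < d → 2 ∣ φ d) → ¬ (2 ∣ n) → 1 < n → 2 ∣ φ n
    step 1             rec 2∤n (s≤s ())
    step n@(suc (suc k)) rec 2∤n 1<n with 2∣n⊎2∣1+n (φ n)
    ... | inj₁ 2∣φn   = 2∣φn
    -- If φ(n) were odd, φ(1) + φ(n) would be even, and with all remaining terms even so would be n.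
    ... | inj₂ 2∣1+φn = contradiction (subst (2 ∣_) n-eq (∣m∣n⇒∣m+n 2∣rest 2∣1+φn)) 2∤n
      where
      -- Here n is `suc (suc k)`, so the range is 2, ..., n - 1: the divisor 1 and n itself are left
      -- out.
      rest = filter (_∣? n) (applyUpTo (suc ∘ suc) k)
      2∣rest : 2 ∣ sum (map φ rest)
      2∣rest = ∣sum 2 (All.map⁺ (All.tabulate even))
        where
        even : ∀ {d} → d ∈ rest → 2 ∣ φ d
        even d∈ with ∈-filter⁻ (_∣? n) {xs = applyUpTo (suc ∘ suc) k} d∈
        ... | d∈range , d∣n with ∈-applyUpTo⁻ (suc ∘ suc) {n = k} d∈range
        ...   | i , i<k , refl = rec (s≤s (s≤s i<k)) (λ 2∣d → 2∤n (∣-trans 2∣d d∣n)) (s≤s (s≤s z≤n))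
      n-eq : sum (map φ rest) + suc (φ n) ≡ n
      n-eq = begin
        sum (map φ rest) + suc (φ n)          ≡⟨ +-suc (sum (map φ rest)) (φ n) ⟩
        -- The successor is absorbed as the summand of the divisor 1, since `φ 1` computes to 1.
        sum (map φ (1 ∷ rest)) + φ n          ≡⟨ cong (λ ds → sum (map φ ds) + φ n)
                                                  (filter-accept (_∣? n) {xs = applyUpTo (suc ∘ suc) k} (1∣ n)) ⟨
        sum (map φ (properDivisors n)) + φ n  ≡⟨ ∑φ-properDivisors n ⟩
        n                                     ∎
        where open ≡-Reasoning

open Totient
  using (divisors; properDivisors; divisors≡properDivisors++; ∈-properDivisors;
         ∑φ≡n; ∑φ-properDivisors; 2∣n⊎2∣1+n; 2∣φ)

-- Fields, finite fields of even order, and characteristic 2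

module FieldProperties (F : Field c ℓ) where
  open Field F
  open SetoidReasoning (CommutativeRing.setoid commutativeRing)

  x⁻¹*[x*y]≈y : ∀ x y → ¬ (x ≈ 0#) → x ⁻¹ * (x * y) ≈ y
  x⁻¹*[x*y]≈y x y x≉0 = begin
    x ⁻¹ * (x * y) ≈⟨ *-assoc _ _ _ ⟨
    (x ⁻¹ * x) * y ≈⟨ *-congʳ (trans (*-comm _ _) (⁻¹-inverse x x≉0)) ⟩
    1# * y         ≈⟨ *-identityˡ y ⟩
    y              ∎

  *-cancelˡ : ∀ x {y z} → ¬ (x ≈ 0#) → x * y ≈ x * z → y ≈ z
  *-cancelˡ x {y} {z} x≉0 xy≈xz = begin
    y              ≈⟨ x⁻¹*[x*y]≈y x y x≉0 ⟨
    x ⁻¹ * (x * y) ≈⟨ *-congˡ xy≈xz ⟩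
    x ⁻¹ * (x * z) ≈⟨ x⁻¹*[x*y]≈y x z x≉0 ⟩
    z              ∎

  x*y≈0⇒y≈0 : ∀ {x y} → ¬ (x ≈ 0#) → x * y ≈ 0# → y ≈ 0#
  x*y≈0⇒y≈0 {x} x≉0 xy≈0 = *-cancelˡ x x≉0 (trans xy≈0 (sym (zeroʳ x)))

module FiniteField (F : Field c ℓ) {q : ℕ} (F↔Fin : Inverse (Field.setoid F) (≡.setoid (Fin q))) where
  open Field F
  open Inverse F↔Fin using (to; from; to-cong; from-cong; strictlyInverseˡ; strictlyInverseʳ)
  open CommutativeMonoidSum +-commutativeMonoid using (sum-permute; sum-cong-≋; sum-replicate; ∑-distrib-+)
    renaming (sum to ∑)
  open RingProperties ring using (+-identityʳ-unique)
  open SemiringMult semiring using (×1-homo-*) renaming (_×_ to _·_)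
  open FieldProperties F
  open SetoidReasoning (CommutativeRing.setoid commutativeRing)

  infix 4 _≈?_
  _≈?_ : ∀ x y → Dec (x ≈ y)
  x ≈? y = map′ (λ eq → trans (sym (strictlyInverseʳ x)) (trans (from-cong eq) (strictlyInverseʳ y)))
                to-cong (to x Fin.≟ to y)

  -- Translation by 1 permutes F, so ∑ x = ∑ (x + 1) = ∑ x + q.
  q·1≈0 : q · 1# ≈ 0#
  q·1≈0 = +-identityʳ-unique (∑ from) (q · 1#) (begin
    ∑ from + q · 1#            ≈⟨ +-congˡ (sum-replicate q) ⟨
    ∑ from + ∑ {q} (λ _ → 1#)  ≈⟨ ∑-distrib-+ from (λ _ → 1#) ⟨
    ∑ (λ i → from i + 1#)      ≈⟨ sum-cong-≋ (λ i → strictlyInverseʳ (from i + 1#)) ⟨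
    ∑ (λ i → from (π ⟨$⟩ʳ i))  ≈⟨ sum-permute from π ⟨
    ∑ from                     ∎)
    where
    shift : Carrier → Fin q → Fin q
    shift x i = to (from i + x)
    shift-inverse : ∀ x y → x + y ≈ 0# → ∀ i → shift y (shift x i) ≡ i
    shift-inverse x y x+y≈0 i = ≡.trans
      (to-cong (begin
        from (shift x i) + y ≈⟨ +-congʳ (strictlyInverseʳ _) ⟩
        (from i + x) + y     ≈⟨ +-assoc _ _ _ ⟩
        from i + (x + y)     ≈⟨ +-congˡ x+y≈0 ⟩
        from i + 0#          ≈⟨ +-identityʳ _ ⟩
        from i               ∎))
      (strictlyInverseˡ i)
    π = permutation (shift 1#) (shift (- 1#))
          (shift-inverse (- 1#) 1# (-‿inverseˡ 1#)) (shift-inverse 1# (- 1#) (-‿inverseʳ 1#))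

  -- A power of k · 1 vanishes, and a field has no nilpotents: unless k · 1 is zero, one factor is
  -- cancelled at a time, down to exponent 0, where 1 = 0 is absurd. The enumeration of F makes the
  -- case split decidable.
  k^e·1≈0⇒k·1≈0 : ∀ k e → (k ^ℕ e) · 1# ≈ 0# → k · 1# ≈ 0#
  k^e·1≈0⇒k·1≈0 k zero    eq = contradiction (trans (sym (+-identityʳ 1#)) eq) 1≉0
  k^e·1≈0⇒k·1≈0 k (suc e) eq with k · 1# ≈? 0#
  ... | yes k≈0 = k≈0
  ... | no  k≉0 = k^e·1≈0⇒k·1≈0 k e (x*y≈0⇒y≈0 k≉0 (trans (sym (×1-homo-* k (k ^ℕ e))) eq))

  q≡2^e⇒1+1≈0 : ∀ e → q ≡ 2 ^ℕ e → 1# + 1# ≈ 0#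
  q≡2^e⇒1+1≈0 e q≡2^e = trans (+-congˡ (sym (+-identityʳ 1#)))
    (k^e·1≈0⇒k·1≈0 2 e (≡.subst (λ m → m · 1# ≈ 0#) q≡2^e q·1≈0))

HasCharacteristic2 : CommutativeRing c ℓ → Set ℓ
HasCharacteristic2 R = 1# + 1# ≈ 0#
  where open CommutativeRing R

module Characteristic2 (R : CommutativeRing c ℓ) (1+1≈0 : HasCharacteristic2 R) where
  open CommutativeRing R
  open import Data.Integer.Base using (+_; -[1+_]; _⊖_)
  open RingProperties ring using (+-inverseˡ-unique)
  open SemiringMult semiring using (×-homo-+; ×1-homo-*) renaming (_×_ to _·_)
  open NaturalSolver commutativeSemiring using (solve; _:=_; _:+_)
  open SetoidReasoning setoid

  x+x≈0 : ∀ x → x + x ≈ 0#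
  x+x≈0 x = begin
    x + x           ≈⟨ +-cong (*-identityˡ x) (*-identityˡ x) ⟨
    1# * x + 1# * x ≈⟨ distribʳ _ _ _ ⟨
    (1# + 1#) * x   ≈⟨ *-congʳ 1+1≈0 ⟩
    0# * x          ≈⟨ zeroˡ x ⟩
    0#              ∎

  -x≈x : ∀ x → - x ≈ x
  -x≈x x = sym (+-inverseˡ-unique x x (x+x≈0 x))

  x+[y+y]≈x : ∀ x y → x + (y + y) ≈ x
  x+[y+y]≈x x y = trans (+-congˡ (x+x≈0 y)) (+-identityʳ x)

  x+y≈0⇒x≈y : ∀ {x y} → x + y ≈ 0# → x ≈ y
  x+y≈0⇒x≈y {x} {y} x+y≈0 = trans (+-inverseˡ-unique x y x+y≈0) (-x≈x y)

  fromℤ′ : ℤ → Carrier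
  fromℤ′ = fromℤ rawRing

  fromℤ-∣∣ : ∀ i → fromℤ′ i ≈ ℤ.∣ i ∣ · 1#
  fromℤ-∣∣ (+ n)    = refl
  fromℤ-∣∣ -[1+ n ] = -x≈x _

  fromℤ-⊖ : ∀ m n → fromℤ′ (m ⊖ n) ≈ m · 1# + n · 1#
  fromℤ-⊖ m       zero    = sym (+-identityʳ _)
  fromℤ-⊖ zero    (suc n) = trans (-x≈x _) (sym (+-identityˡ _))
  fromℤ-⊖ (suc m) (suc n) = begin
    fromℤ′ (suc m ⊖ suc n)               ≡⟨ ≡.cong fromℤ′ (ℤ.[1+m]⊖[1+n]≡m⊖n m n) ⟩
    fromℤ′ (m ⊖ n)                       ≈⟨ fromℤ-⊖ m n ⟩
    -- Since 1 + 1 = 0, one unit can be added to each of the two counts.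
    m · 1# + n · 1#                      ≈⟨ x+[y+y]≈x _ 1# ⟨
    (m · 1# + n · 1#) + (1# + 1#)        ≈⟨ solve 3 (λ x y z → (x :+ y) :+ (z :+ z) := (z :+ x) :+ (z :+ y)) refl _ _ _ ⟩
    (1# + m · 1#) + (1# + n · 1#)        ∎

  fromℤ-+ : ∀ i j → fromℤ′ (i ℤ.+ j) ≈ fromℤ′ i + fromℤ′ j
  fromℤ-+ (+ m)    (+ n)    = ×-homo-+ 1# m n
  fromℤ-+ (+ m)    -[1+ n ] = trans (fromℤ-⊖ m (suc n)) (+-congˡ (sym (-x≈x _)))
  fromℤ-+ -[1+ m ] (+ n)    =
    trans (fromℤ-⊖ n (suc m)) (trans (+-comm _ _) (+-congʳ (sym (-x≈x _))))
  fromℤ-+ -[1+ m ] -[1+ n ] = begin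
    - (suc (suc (m +ℕ n)) · 1#)       ≈⟨ -x≈x _ ⟩
    suc (suc (m +ℕ n)) · 1#           ≡⟨ ≡.cong (λ k → suc k · 1#) (ℕ.+-suc m n) ⟨
    (suc m +ℕ suc n) · 1#             ≈⟨ ×-homo-+ 1# (suc m) (suc n) ⟩
    suc m · 1# + suc n · 1#           ≈⟨ +-cong (-x≈x _) (-x≈x _) ⟨
    - (suc m · 1#) + - (suc n · 1#)   ∎

  -- Signs are lost in characteristic 2, so only absolute values matter, and these are
  -- multiplicative.
  fromℤ-* : ∀ i j → fromℤ′ (i ℤ.* j) ≈ fromℤ′ i * fromℤ′ j
  fromℤ-* i j = begin
    fromℤ′ (i ℤ.* j)                       ≈⟨ fromℤ-∣∣ (i ℤ.* j) ⟩
    ℤ.∣ i ℤ.* j ∣ · 1#                     ≡⟨ ≡.cong (_· 1#) (ℤ.∣i*j∣≡∣i∣*∣j∣ i j) ⟩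
    (ℤ.∣ i ∣ *ℕ ℤ.∣ j ∣) · 1#              ≈⟨ ×1-homo-* ℤ.∣ i ∣ ℤ.∣ j ∣ ⟩
    (ℤ.∣ i ∣ · 1#) * (ℤ.∣ j ∣ · 1#)        ≈⟨ *-cong (fromℤ-∣∣ i) (fromℤ-∣∣ j) ⟨
    fromℤ′ i * fromℤ′ j                    ∎

  fromℤ-homo : IsHomomorphism ℤ.+-*-commutativeRing R fromℤ′
  fromℤ-homo = mkHomomorphism ℤ.+-*-commutativeRing R
    (λ { ≡.refl → refl }) fromℤ-+ refl fromℤ-* (+-identityʳ 1#)

-- Lucas sequences in a commutative ring

odd⇒1+2k : ∀ n → ¬ (2 ∣ n) → ∃[ k ] n ≡ suc (k *ℕ 2)
odd⇒1+2k n 2∤n with 2∣n⊎2∣1+n n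
... | inj₁ 2∣n                      = contradiction 2∣n 2∤n
... | inj₂ (divides (suc k) ≡.refl) = k , ≡.refl

-- An arbitrary ring is allowed so that 𝒰 can be carried along homomorphisms, both into K and, by
-- specialising B and C, into F.
record IsLucasSequence (R : CommutativeRing c₁ ℓ₁) (b c : CommutativeRing.Carrier R)
                       (u : ℕ → CommutativeRing.Carrier R) : Set ℓ₁ where
  open CommutativeRing R
  field
    u₀   : u 0 ≈ 0#
    u₁   : u 1 ≈ 1#
    step : ∀ n → u (suc (suc n)) ≈ (- b) * u (suc n) + - (c * u n)

module LucasSequence (R : CommutativeRing c₁ ℓ₁) (S : CommutativeRing c₂ ℓ₂) where
  private
    module R = CommutativeRing R
  open CommutativeRing S
  open RingProperties ring using (-‿distribˡ-*; -‿distribʳ-*)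
  open SetoidReasoning setoid

  module _ {σ : R.Carrier → Carrier} (σ-homo : IsHomomorphism R S σ)
           {b² c′ : R.Carrier} {b c : Carrier} (σ-b² : σ b² ≈ b * b) (σ-c′ : σ c′ ≈ c)
           {u : ℕ → Carrier} (u-lucas : IsLucasSequence S b c u) where
    open RingMorphisms.IsRingHomomorphism σ-homo
      using () renaming (+-homo to σ-+; *-homo to σ-*; -‿homo to σ-neg; 0#-homo to σ-0; 1#-homo to σ-1)
    open IsLucasSequence u-lucas

    -- The recurrence reaches back two terms, so the two parities are carried together. Recording
    -- the even-indexed terms divided by `b` keeps all witnesses in the source of `σ`.
    lucas-parity : ∀ k → (∃[ s ] u (k *ℕ 2) ≈ b * σ s) × (∃[ t ] u (suc (k *ℕ 2)) ≈ σ t)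
    lucas-parity zero =
      (R.0# , trans u₀ (sym (trans (*-congˡ σ-0) (zeroʳ b)))) , (R.1# , trans u₁ (sym σ-1))
    lucas-parity (suc k) with lucas-parity k
    ... | (s , even) , (t , odd) = (s′ , even′) , (t′ , odd′)
      where
      -- The recurrence for the pair u(2k)/b, u(2k+1): the even step sheds a factor b, and the odd
      -- step turns b · b into the image of `b²`.
      s′ = R.- t R.+ R.- (c′ R.* s)
      t′ = R.- (b² R.* s′) R.+ R.- (c′ R.* t)
      σ-c* : ∀ x → σ (c′ R.* x) ≈ c * σ x
      σ-c* x = trans (σ-* c′ x) (*-congʳ σ-c′)
      even′ : u (suc k *ℕ 2) ≈ b * σ s′
      even′ = begin
        u (suc k *ℕ 2)                              ≈⟨ step (k *ℕ 2) ⟩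
        - b * u (suc (k *ℕ 2)) + - (c * u (k *ℕ 2)) ≈⟨ +-cong (*-congˡ odd) (-‿cong (*-congˡ even)) ⟩
        - b * σ t + - (c * (b * σ s))               ≈⟨ +-cong
          (trans (sym (-‿distribˡ-* _ _)) (-‿distribʳ-* _ _))
          (trans (-‿cong (trans (sym (*-assoc _ _ _)) (trans (*-congʳ (*-comm c b)) (*-assoc _ _ _))))
                 (-‿distribʳ-* _ _)) ⟩
        b * (- σ t) + b * (- (c * σ s))             ≈⟨ distribˡ _ _ _ ⟨
        b * (- σ t + - (c * σ s))                   ≈⟨ *-congˡ (+-cong (σ-neg t) (trans (σ-neg _) (-‿cong (σ-c* s)))) ⟨
        b * (σ (R.- t) + σ (R.- (c′ R.* s)))        ≈⟨ *-congˡ (σ-+ _ _) ⟨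
        b * σ s′                                    ∎
      odd′ : u (suc (suc k *ℕ 2)) ≈ σ t′
      odd′ = begin
        u (suc (suc k *ℕ 2))                            ≈⟨ step (suc (k *ℕ 2)) ⟩
        - b * u (suc k *ℕ 2) + - (c * u (suc (k *ℕ 2))) ≈⟨ +-cong (*-congˡ even′) (-‿cong (*-congˡ odd)) ⟩
        - b * (b * σ s′) + - (c * σ t)                  ≈⟨ +-congʳ (trans (sym (-‿distribˡ-* _ _))
                                                            (-‿cong (sym (*-assoc _ _ _)))) ⟩
        - (b * b * σ s′) + - (c * σ t)                  ≈⟨ +-cong
          (trans (σ-neg _) (-‿cong (trans (σ-* b² s′) (*-congʳ σ-b²))))
          (trans (σ-neg _) (-‿cong (σ-c* t))) ⟨
        σ (R.- (b² R.* s′)) + σ (R.- (c′ R.* t))        ≈⟨ σ-+ _ _ ⟨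
        σ t′                                            ∎

  module _ {ψ : R.Carrier → Carrier} (ψ-homo : IsHomomorphism R S ψ)
           {b c : R.Carrier} {u : ℕ → R.Carrier} (u-lucas : IsLucasSequence R b c u) where
    open RingMorphisms.IsRingHomomorphism ψ-homo

    homomorphic-image : IsLucasSequence S (ψ b) (ψ c) (ψ ∘ u)
    homomorphic-image = record
      { u₀   = trans (⟦⟧-cong u₀) 0#-homo
      ; u₁   = trans (⟦⟧-cong u₁) 1#-homo
      ; step = λ n → trans (⟦⟧-cong (step n)) (trans (+-homo _ _) (+-cong
          (trans (*-homo _ _) (*-congʳ (-‿homo b)))
          (trans (-‿homo _) (-‿cong (*-homo c (u n))))))
      }
      where open IsLucasSequence u-lucas

module LucasCharacteristic2 (R : CommutativeRing c ℓ) (1+1≈0 : HasCharacteristic2 R) where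
  open CommutativeRing R
  open Characteristic2 R 1+1≈0
  open SemiringExp semiring using (_^_)
  open NaturalSolver commutativeSemiring using (solve; _:=_; _:+_; _:*_)
  open SetoidReasoning setoid

  module _ {b c : Carrier} {u : ℕ → Carrier} (u-lucas : IsLucasSequence R b c u) where
    open IsLucasSequence u-lucas

    step₂ : ∀ n → u (suc (suc n)) ≈ b * u (suc n) + c * u n
    step₂ n = trans (step n) (+-cong (*-congʳ (-x≈x b)) (-x≈x _))

    lucas-odd-0-1 : b ≈ 0# → c ≈ 1# → ∀ k → u (suc (k *ℕ 2)) ≈ 1#
    lucas-odd-0-1 b≈0 c≈1 zero    = u₁
    lucas-odd-0-1 b≈0 c≈1 (suc k) = begin
      u (suc (suc k *ℕ 2))                        ≈⟨ step₂ (suc (k *ℕ 2)) ⟩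
      b * u (suc k *ℕ 2) + c * u (suc (k *ℕ 2))   ≈⟨ +-cong (trans (*-congʳ b≈0) (zeroˡ _))
                                                       (*-cong c≈1 (lucas-odd-0-1 b≈0 c≈1 k)) ⟩
      0# + 1# * 1#                                ≈⟨ trans (+-identityˡ _) (*-identityˡ _) ⟩
      1#                                          ∎

    -- Binet's formula (αⁿ - βⁿ)/(α - β) cleared of its denominator. In characteristic 2 the
    -- differences are sums, and the denominator is `b`.
    binet : ∀ {α β} → α + β ≈ b → α * β ≈ c → ∀ n → α ^ n + β ^ n ≈ b * u n
    binet {α} {β} α+β≈b αβ≈c zero = begin
      1# + 1# ≈⟨ 1+1≈0 ⟩
      0#      ≈⟨ zeroʳ b ⟨
      b * 0#  ≈⟨ *-congˡ u₀ ⟨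
      b * u 0 ∎
    binet {α} {β} α+β≈b αβ≈c (suc zero) = begin
      α * 1# + β * 1# ≈⟨ +-cong (*-identityʳ α) (*-identityʳ β) ⟩
      α + β           ≈⟨ α+β≈b ⟩
      b               ≈⟨ trans (*-congˡ u₁) (*-identityʳ b) ⟨
      b * u 1         ∎
    binet {α} {β} α+β≈b αβ≈c (suc (suc n)) = begin
      -- Adding αβ(x + y) twice changes nothing and completes (α + β)(αx + βy). Such doubled terms
      -- take the place of subtraction, which the natural-coefficient solver cannot express.
      α * (α * x) + β * (β * y)                          ≈⟨ x+[y+y]≈x _ (α * β * (x + y)) ⟨
      (α * (α * x) + β * (β * y)) + (α * β * (x + y) + α * β * (x + y))
        ≈⟨ solve 4 (λ α β x y →
             (α :* (α :* x) :+ β :* (β :* y)) :+ (α :* β :* (x :+ y) :+ α :* β :* (x :+ y))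
             := (α :+ β) :* (α :* x :+ β :* y) :+ α :* β :* (x :+ y)) refl α β x y ⟩
      (α + β) * (α * x + β * y) + α * β * (x + y)        ≈⟨ +-cong
        (*-cong α+β≈b (binet α+β≈b αβ≈c (suc n))) (*-cong αβ≈c (binet α+β≈b αβ≈c n)) ⟩
      b * (b * u (suc n)) + c * (b * u n)                ≈⟨ solve 4 (λ b c x y →
             b :* (b :* x) :+ c :* (b :* y) := b :* (b :* x :+ c :* y)) refl b c _ _ ⟩
      b * (b * u (suc n) + c * u n)                      ≈⟨ *-congˡ (step₂ n) ⟨
      b * u (suc (suc n))                                ∎
      where
      x = α ^ n
      y = β ^ n

-- The ring F[B,C] and its subring F[B²,C]

module BivariateProperties (F : Field c ℓ) where
  open Bivariate F
  F₀ : CommutativeRing c ℓ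
  F₀ = Field.commutativeRing F
  F[B] : CommutativeRing c ℓ
  F[B] = PolynomialRing.polynomialRing F₀
  R : CommutativeRing c ℓ
  R = PolynomialRing.polynomialRing F[B]
  open CommutativeRing R
  open SemiringExp semiring using (_^_)

  scalar-homo : IsHomomorphism F₀ R scalar
  scalar-homo = Composition.isRingHomomorphism trans (const-homo F₀) (const-homo F[B])

  -- The image of this endomorphism is F[B²,C]. On its source the variable `B` is the name of B², so
  -- `B` is later supplied both for the parameter `b²` and for `b`.
  σ : Carrier → Carrier
  σ = substBC (B ^ 2) C

  private
    module Inner = Evaluation F₀ R scalar-homo (B ^ 2)
    module Outer = Evaluation F[B] R Inner.evalₛ-homo C

  σ-homo : IsHomomorphism R R σ
  σ-homo = Outer.evalₛ-homo

  σ-B : σ B ≈ B * B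
  σ-B = trans {σ B} (Outer.evalₛ-const (Poly.X (Field.rawRing F)))
          (trans {j = B ^ 2} Inner.evalₛ-X (*-congˡ {B} (*-identityʳ B)))

  σ-C : σ C ≈ C
  σ-C = Outer.evalₛ-X

  σ-scalar : ∀ a → σ (scalar a) ≈ scalar a
  σ-scalar a = trans {σ (scalar a)} (Outer.evalₛ-const (Poly.const (Field.rawRing F) a)) (Inner.evalₛ-const a)

  𝒰-lucas : IsLucasSequence R B C 𝒰
  𝒰-lucas = record { u₀ = refl ; u₁ = refl ; step = λ n → refl }

  𝒰-odd∈F[B²,C] : ∀ n → ¬ (2 ∣ n) → 𝒰 n ∈F[B²,C]
  𝒰-odd∈F[B²,C] n 2∤n with odd⇒1+2k n 2∤n
  ... | k , ≡.refl =
    proj₂ (LucasSequence.lucas-parity R R σ-homo {B} {C} {B} {C} σ-B σ-C 𝒰-lucas k)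

  B≉0 : ¬ (B ≈ 0#)
  B≉0 B≈0 = Field.1≉0 F (Poly._≋_.coeff≈ (Poly._≋_.coeff≈ B≈0 0) 1)

  C≉0 : ¬ (C ≈ 0#)
  C≉0 C≈0 = Field.1≉0 F (Poly._≋_.coeff≈ (Poly._≋_.coeff≈ C≈0 1) 0)

  module _ (1+1≈0 : HasCharacteristic2 F₀) where

    -- Specialising B ↦ 0 and C ↦ 1 turns the recurrence into u (n + 2) = u n.
    𝒰-odd≉0 : ∀ n → ¬ (2 ∣ n) → ¬ (𝒰 n ≈ 0#)
    𝒰-odd≉0 n 2∤n 𝒰n≈0 with odd⇒1+2k n 2∤n
    ... | k , ≡.refl = F.1≉0 (F.trans
      (F.sym (LucasCharacteristic2.lucas-odd-0-1 F₀ 1+1≈0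
        (LucasSequence.homomorphic-image R F₀ At-C.evalₛ-homo 𝒰-lucas)
        (F.trans (At-C.evalₛ-const (Poly.X F.rawRing)) At-B.evalₛ-X) At-C.evalₛ-X k))
      (At-C.evalₛ-cong {𝒰 n} {0#} 𝒰n≈0))
      where
      module F = Field F
      module At-B = Evaluation F₀ F₀ (Identity.isRingHomomorphism F.rawRing F.refl) F.0#
      module At-C = Evaluation F[B] F₀ At-B.evalₛ-homo F.1#

-- Forms of even degree in the two roots

-- With A = F[B²,C] inside K and b, c the images of B, C: since the roots
-- satisfy γ² = bγ + c, both A + A(bα) and A + A(bβ) are rings, and conjugation
-- (α ↦ β) keeps the coordinates s, r.  Forms of even degree in α, β live there.
module EvenForms (A : CommutativeRing c₁ ℓ₁) (K : CommutativeRing c₂ ℓ₂)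
                 (1+1≈0 : HasCharacteristic2 K)
                 {σ : CommutativeRing.Carrier A → CommutativeRing.Carrier K}
                 (σ-homo : IsHomomorphism A K σ) where
  private
    module A = CommutativeRing A
  open CommutativeRing K
  open Characteristic2 K 1+1≈0
  open RingMorphisms.IsRingHomomorphism σ-homo
    using () renaming (+-homo to σ-+; *-homo to σ-*; 0#-homo to σ-0; 1#-homo to σ-1)
  open SemiringExp semiring using (_^_)
  open NaturalSolver commutativeSemiring using (solve; _:=_; _:+_; _:*_; con)
  open SetoidReasoning setoid

  module Roots {b² c′ : A.Carrier} {b c α β : Carrier}
               (σ-b² : σ b² ≈ b * b) (σ-c′ : σ c′ ≈ c)
               (α+β≈b : α + β ≈ b) (αβ≈c : α * β ≈ c) where

    value : Carrier → A.Carrier × A.Carrier → Carrier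
    value γ (s , r) = σ s + σ r * (b * γ)

    infixl 6 _⊞_
    infixl 7 _⊠_
    -- `⊠` is multiplication of s + r θ modulo θ² = b² θ + b² c, the equation that θ = bγ inherits
    -- from γ² = bγ + c. It does not mention γ, so it serves both roots.
    _⊞_ _⊠_ : (v w : A.Carrier × A.Carrier) → A.Carrier × A.Carrier
    (s , r) ⊞ (s′ , r′) = s A.+ s′ , r A.+ r′
    (s , r) ⊠ (s′ , r′) =
      s A.* s′ A.+ r A.* r′ A.* (b² A.* c′) , s A.* r′ A.+ r A.* s′ A.+ r A.* r′ A.* b²

    value-⊞ : ∀ γ v w → value γ (v ⊞ w) ≈ value γ v + value γ w
    value-⊞ γ (s , r) (s′ , r′) = begin
      σ (s A.+ s′) + σ (r A.+ r′) * (b * γ)             ≈⟨ +-cong (σ-+ s s′) (*-congʳ (σ-+ r r′)) ⟩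
      (σ s + σ s′) + (σ r + σ r′) * (b * γ)             ≈⟨ solve 5 (λ s s′ r r′ θ →
        (s :+ s′) :+ (r :+ r′) :* θ := (s :+ r :* θ) :+ (s′ :+ r′ :* θ)) refl _ _ _ _ _ ⟩
      (σ s + σ r * (b * γ)) + (σ s′ + σ r′ * (b * γ))   ∎

    value-⊠ : ∀ γ → γ * γ ≈ b * γ + c → ∀ v w → value γ (v ⊠ w) ≈ value γ v * value γ w
    value-⊠ γ γ² (s , r) (s′ , r′) = begin
      σ (s A.* s′ A.+ r A.* r′ A.* (b² A.* c′)) + σ (s A.* r′ A.+ r A.* s′ A.+ r A.* r′ A.* b²) * (b * γ)
        ≈⟨ +-cong
          (trans (σ-+ _ _) (+-cong (σ-* s s′)
            (trans (σ-* _ _) (*-cong (σ-* r r′) (trans (σ-* b² c′) (*-cong σ-b² σ-c′))))))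
          (*-congʳ (trans (σ-+ _ _) (+-cong (trans (σ-+ _ _) (+-cong (σ-* s r′) (σ-* r s′)))
            (trans (σ-* _ _) (*-cong (σ-* r r′) σ-b²))))) ⟩
      (σ s * σ s′ + σ r * σ r′ * (b * b * c)) + (σ s * σ r′ + σ r * σ s′ + σ r * σ r′ * (b * b)) * (b * γ)
        ≈⟨ solve 7 (λ s r s′ r′ b c γ →
             (s :* s′ :+ r :* r′ :* (b :* b :* c)) :+ (s :* r′ :+ r :* s′ :+ r :* r′ :* (b :* b)) :* (b :* γ)
             := (s :* s′ :+ (s :* r′ :+ r :* s′) :* (b :* γ)) :+ r :* r′ :* (b :* b) :* (b :* γ :+ c))
             refl _ _ _ _ _ _ _ ⟩
      (σ s * σ s′ + (σ s * σ r′ + σ r * σ s′) * (b * γ)) + σ r * σ r′ * (b * b) * (b * γ + c)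
        ≈⟨ +-congˡ (*-congˡ γ²) ⟨
      (σ s * σ s′ + (σ s * σ r′ + σ r * σ s′) * (b * γ)) + σ r * σ r′ * (b * b) * (γ * γ)
        ≈⟨ solve 6 (λ s r s′ r′ b γ →
             (s :* s′ :+ (s :* r′ :+ r :* s′) :* (b :* γ)) :+ r :* r′ :* (b :* b) :* (γ :* γ)
             := (s :+ r :* (b :* γ)) :* (s′ :+ r′ :* (b :* γ))) refl _ _ _ _ _ _ ⟩
      (σ s + σ r * (b * γ)) * (σ s′ + σ r′ * (b * γ)) ∎

    private
      root : ∀ {x y} → x + y ≈ b → x * y ≈ c → x * x ≈ b * x + c
      root {x} {y} x+y≈b xy≈c = begin
        x * x                 ≈⟨ x+[y+y]≈x _ (x * y) ⟨
        x * x + (x * y + x * y) ≈⟨ solve 2 (λ x y → x :* x :+ (x :* y :+ x :* y) := (x :+ y) :* x :+ x :* y) refl x y ⟩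
        (x + y) * x + x * y   ≈⟨ +-cong (*-congʳ x+y≈b) xy≈c ⟩
        b * x + c             ∎

      -- Here y² = by + c is rewritten through y = b + x, because the square of one root is needed
      -- in the coordinates belonging to the other.
      conjugate-root : ∀ {x y} → x + y ≈ b → x * y ≈ c → y * y ≈ (b * b + c) + b * x
      conjugate-root {x} {y} x+y≈b xy≈c = begin
        y * y                                   ≈⟨ root (trans (+-comm y x) x+y≈b) (trans (*-comm y x) xy≈c) ⟩
        b * y + c                               ≈⟨ x+[y+y]≈x _ (b * x) ⟨
        (b * y + c) + (b * x + b * x)           ≈⟨ solve 4 (λ b c x y →
          (b :* y :+ c) :+ (b :* x :+ b :* x) := (b :* (x :+ y) :+ c) :+ b :* x) refl b c x y ⟩
        (b * (x + y) + c) + b * x               ≈⟨ +-congʳ (+-congʳ (*-congˡ x+y≈b)) ⟩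
        (b * b + c) + b * x                     ∎

      β+α≈b = trans (+-comm β α) α+β≈b
      βα≈c = trans (*-comm β α) αβ≈c

    -- One pair of coordinates read at α and at β. This relation stands for the automorphism
    -- exchanging the roots, without any such map being constructed.
    Conjugate : Carrier → Carrier → Set _
    Conjugate x y = ∃[ w ] (value α w ≈ x × value β w ≈ y)

    conj-resp : ∀ {x x′ y y′} → x ≈ x′ → y ≈ y′ → Conjugate x y → Conjugate x′ y′
    conj-resp x≈x′ y≈y′ (w , p , q) = w , trans p x≈x′ , trans q y≈y′

    conj-+ : ∀ {x x′ y y′} → Conjugate x y → Conjugate x′ y′ → Conjugate (x + x′) (y + y′)
    conj-+ (v , p , q) (w , p′ , q′) =
      v ⊞ w , trans (value-⊞ α v w) (+-cong p p′) , trans (value-⊞ β v w) (+-cong q q′)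

    conj-* : ∀ {x x′ y y′} → Conjugate x y → Conjugate x′ y′ → Conjugate (x * x′) (y * y′)
    conj-* (v , p , q) (w , p′ , q′) =
      v ⊠ w ,
      trans (value-⊠ α (root α+β≈b αβ≈c) v w) (*-cong p p′) ,
      trans (value-⊠ β (root β+α≈b βα≈c) v w) (*-cong q q′)

    conj-σ : ∀ a → Conjugate (σ a) (σ a)
    conj-σ a = (a , A.0#) , constant α , constant β
      where
      constant : ∀ γ → value γ (a , A.0#) ≈ σ a
      constant γ = trans (+-congˡ (trans (*-congʳ σ-0) (zeroˡ _))) (+-identityʳ _)

    private
      value-s-1 : ∀ {s x} γ → σ s ≈ x → value γ (s , A.1#) ≈ x + b * γ
      value-s-1 γ σs≈x = +-cong σs≈x (trans (*-congʳ σ-1) (*-identityˡ _))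

    conj-α² : Conjugate (α * α) (β * β)
    conj-α² = (c′ , A.1#) ,
      trans (value-s-1 α σ-c′) (trans (+-comm _ _) (sym (root α+β≈b αβ≈c))) ,
      trans (value-s-1 β σ-c′) (trans (+-comm _ _) (sym (root β+α≈b βα≈c)))

    conj-β² : Conjugate (β * β) (α * α)
    conj-β² = (b² A.+ c′ , A.1#) ,
      trans (value-s-1 α σ-b²+c′) (sym (conjugate-root α+β≈b αβ≈c)) ,
      trans (value-s-1 β σ-b²+c′) (sym (conjugate-root β+α≈b βα≈c))
      where σ-b²+c′ = trans (σ-+ b² c′) (+-cong σ-b² σ-c′)

    conj-αβ : Conjugate (α * β) (β * α)
    conj-αβ = conj-resp (trans σ-c′ (sym αβ≈c)) (trans σ-c′ (sym βα≈c)) (conj-σ c′)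

    -- Even total degree lets the factors be removed in pairs α² or β² until 1 or αβ is left; a
    -- single α or β would have odd degree.
    conj-monomial : ∀ k i j → i +ℕ j ≡ k *ℕ 2 → Conjugate (α ^ i * β ^ j) (β ^ i * α ^ j)
    conj-monomial k zero zero i+j≡2k =
      conj-resp (trans σ-1 (sym (*-identityʳ 1#))) (trans σ-1 (sym (*-identityʳ 1#))) (conj-σ A.1#)
    conj-monomial (suc k) (suc zero) (suc zero) i+j≡2k =
      conj-resp (sym (*-cong (*-identityʳ α) (*-identityʳ β)))
                (sym (*-cong (*-identityʳ β) (*-identityʳ α))) conj-αβ
    conj-monomial zero    (suc zero) zero ()
    conj-monomial (suc k) (suc zero) zero ()
    conj-monomial zero    zero (suc zero) ()
    conj-monomial (suc k) zero (suc zero) ()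
    conj-monomial (suc k) (suc (suc i)) j i+j≡2k =
      conj-resp (regroup α β) (regroup β α)
        (conj-* conj-α² (conj-monomial k i j (ℕ.suc-injective (ℕ.suc-injective i+j≡2k))))
      where
      regroup : ∀ x y → x * x * (x ^ i * y ^ j) ≈ x * (x * x ^ i) * y ^ j
      regroup x y = solve 3 (λ x p q → x :* x :* (p :* q) := x :* (x :* p) :* q) refl x _ _
    conj-monomial (suc k) i (suc (suc j)) i+j≡2k =
      conj-resp (regroup α β) (regroup β α)
        (conj-* conj-β² (conj-monomial k i j (ℕ.suc-injective (ℕ.suc-injective
          (≡.trans (≡.sym (≡.trans (ℕ.+-suc i (suc j)) (≡.cong suc (ℕ.+-suc i j)))) i+j≡2k)))))
      where
      regroup : ∀ x y → y * y * (x ^ i * y ^ j) ≈ x ^ i * (y * (y * y ^ j))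
      regroup x y = solve 3 (λ y p q → y :* y :* (p :* q) := p :* (y :* (y :* q))) refl y _ _

    module _ {z ℓz} (Z : CommutativeRing z ℓz) {f : CommutativeRing.Carrier Z → Carrier}
             (f-homo : IsHomomorphism Z K f) (f∈σ : ∀ z → ∃[ a ] σ a ≈ f z)
             {t t′ : Carrier} (tβ≈α : t * β ≈ α) (t′α≈β : t′ * α ≈ β) where
      private
        module E  = Evaluation Z K f-homo t
        module E′ = Evaluation Z K f-homo t′
      open Degree Z using (Degree≤)

      conj-coefficient : ∀ z → Conjugate (f z) (f z)
      conj-coefficient z with f∈σ z
      ... | s , σs≈fz = conj-resp σs≈fz σs≈fz (conj-σ s)

      -- Horner's scheme made homogeneous: β^(d+1) (a + t e) = a β^(d+1) + α β^d e, as tβ = α. The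
      -- exponent `i` collects the powers of α split off, so `i + d` stays constant and even. The
      -- degree bound guarantees that only a constant remains once the powers of β are used up.
      conj-form : ∀ k p d i → Degree≤ p d → i +ℕ d ≡ k *ℕ 2 →
                  Conjugate (α ^ i * (β ^ d * E.evalₛ p)) (β ^ i * (α ^ d * E′.evalₛ p))
      conj-form k [] d i deg i+d≡2k =
        conj-resp (vanish α β) (vanish β α) (conj-σ A.0#)
        where
        vanish : ∀ x y → σ A.0# ≈ x ^ i * (y ^ d * 0#)
        vanish x y = trans σ-0 (sym (trans (*-congˡ (zeroʳ _)) (zeroʳ _)))
      conj-form k (a ∷ p) zero i deg i≡2k =
        conj-resp (constant α β t (E.evalₛ-[] p p≋[])) (constant β α t′ (E′.evalₛ-[] p p≋[]))
          (conj-* (conj-coefficient a) (conj-monomial k i 0 i≡2k))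
        where
        p≋[] = Poly.mk≋ λ j → deg (suc j) z<s
        constant : ∀ x y t {e} → e ≈ 0# → f a * (x ^ i * 1#) ≈ x ^ i * (1# * (f a + t * e))
        constant x y t {e} e≈0 = begin
          f a * (x ^ i * 1#)              ≈⟨ solve 2 (λ a x → a :* (x :* con 1) := x :* (con 1 :* (a :+ con 0))) refl _ _ ⟩
          x ^ i * (1# * (f a + 0#))       ≈⟨ *-congˡ (*-congˡ (+-congˡ (trans (*-congˡ e≈0) (zeroʳ t)))) ⟨
          x ^ i * (1# * (f a + t * e))    ∎
      conj-form k (a ∷ p) (suc d) i deg i+d≡2k =
        conj-resp (horner t tβ≈α) (horner t′ t′α≈β)
          (conj-+ (conj-* (conj-coefficient a) (conj-monomial k i (suc d) i+d≡2k))
                  (conj-form k p d (suc i) (λ j d<j → deg (suc j) (s<s d<j))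
                    (≡.trans (≡.sym (ℕ.+-suc i d)) i+d≡2k)))
        where
        horner : ∀ {x y e} t → t * y ≈ x →
                 f a * (x ^ i * (y * y ^ d)) + x * x ^ i * (y ^ d * e) ≈ x ^ i * (y * y ^ d * (f a + t * e))
        horner {x} {y} {e} t ty≈x = begin
          f a * (x ^ i * (y * y ^ d)) + x * x ^ i * (y ^ d * e)       ≈⟨ +-congˡ (*-congʳ (*-congʳ ty≈x)) ⟨
          f a * (x ^ i * (y * y ^ d)) + t * y * x ^ i * (y ^ d * e)   ≈⟨ solve 6 (λ a x y z t e →
            a :* (x :* (y :* z)) :+ t :* y :* x :* (z :* e) := x :* (y :* z :* (a :+ t :* e))) refl _ _ _ _ _ _ ⟩
          x ^ i * (y * y ^ d * (f a + t * e))                         ∎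

    -- For w = (s , r), the difference of the two conjugates is r b (α - β) = r b².
    self-conjugate∈σ : (∀ {x} → b * x ≈ 0# → x ≈ 0#) →
                       ∀ {x y} → Conjugate x y → x ≈ y → ∃[ s ] σ s ≈ x
    self-conjugate∈σ b-cancel {x} {y} ((s , r) , p , q) x≈y = s , (begin
      σ s                    ≈⟨ +-identityʳ _ ⟨
      σ s + 0#               ≈⟨ +-congˡ (trans (*-congʳ σr≈0) (zeroˡ _)) ⟨
      σ s + σ r * (b * α)    ≈⟨ p ⟩
      x                      ∎)
      where
      σr≈0 : σ r ≈ 0#
      σr≈0 = b-cancel (b-cancel (begin
        b * (b * σ r)                                  ≈⟨ *-congˡ (*-congʳ α+β≈b) ⟨
        b * ((α + β) * σ r)                            ≈⟨ x+[y+y]≈x _ (σ s) ⟨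
        b * ((α + β) * σ r) + (σ s + σ s)              ≈⟨ solve 5 (λ s r b α β →
          b :* ((α :+ β) :* r) :+ (s :+ s) := (s :+ r :* (b :* α)) :+ (s :+ r :* (b :* β))) refl _ _ _ _ _ ⟩
        (σ s + σ r * (b * α)) + (σ s + σ r * (b * β))  ≈⟨ +-cong (trans p x≈y) q ⟩
        y + y                                          ≈⟨ x+x≈0 y ⟩
        0#                                             ∎))

-- Cyclotomic polynomials: degrees and homogenised products

module Product (R : CommutativeRing c ℓ) where
  open CommutativeRing R

  ∏ : List Carrier → Carrier
  ∏ = foldr _*_ 1#

  ∏-∷ʳ : ∀ xs x → ∏ (xs ++ [ x ]) ≈ ∏ xs * x
  ∏-∷ʳ []       x = *-comm x 1#
  ∏-∷ʳ (y ∷ xs) x = trans (*-congˡ (∏-∷ʳ xs x)) (sym (*-assoc y _ x))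

  ∏-cong : ∀ {a} {A : Set a} {f g : A → Carrier} {xs} →
           All (λ x → f x ≈ g x) xs → ∏ (map f xs) ≈ ∏ (map g xs)
  ∏-cong []             = refl
  ∏-cong (fx≈gx ∷ rest) = *-cong fx≈gx (∏-cong rest)

  ∏-divisors : ∀ (f : ℕ → Carrier) n .{{_ : NonZero n}} →
               ∏ (map f (divisors n)) ≈ ∏ (map f (properDivisors n)) * f n
  ∏-divisors f n =
    trans (reflexive (≡.cong ∏ (≡.trans (≡.cong (map f) (divisors≡properDivisors++ n))
                                        (List.map-++ f (properDivisors n) [ n ]))))
          (∏-∷ʳ (map f (properDivisors n)) (f n))

ℤ[X] : CommutativeRing _ _
ℤ[X] = PolynomialRing.polynomialRing ℤ.+-*-commutativeRing

All-properDivisors : ∀ {p} {P : ℕ → Set p} n →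
                     (∀ {d} → 1 ≤ d → d < n → d ∣ n → P d) → All P (properDivisors n)
All-properDivisors n P-d = All.tabulate λ d∈ →
  let 1≤d , d<n , d∣n = ∈-properDivisors d∈ in P-d 1≤d d<n d∣n

module CyclotomicDegree where
  open CommutativeRing ℤ[X]
  open Poly ℤ₀ using (coeff; X; _⊗_)
  open PolynomialRing ℤ.+-*-commutativeRing using (coeff-⊕)
  open Degree ℤ.+-*-commutativeRing public
  open SemiringExp semiring using (_^_)
  open Product ℤ[X]

  degree-⊗ℤ : ∀ p q {d e} → HasDegree p d → HasDegree q e → HasDegree (p ⊗ q) (d +ℕ e)
  degree-⊗ℤ = degree-⊗ (λ {i} → ℤ.i*j≡0⇒i≡0∨j≡0 i)

  degree-1 : HasDegree 1# 0
  degree-1 = (λ ()) , λ { (suc i) _ → ≡.refl }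

  degree-Xⁿ : ∀ n → HasDegree (X ^ n) n
  degree-Xⁿ zero    = degree-1
  degree-Xⁿ (suc n) = degree-⊗ℤ X (X ^ n)
    ((λ ()) , λ { (suc (suc i)) _ → ≡.refl ; (suc zero) (s≤s ()) }) (degree-Xⁿ n)

  degree-Xⁿ-1 : ∀ n .{{_ : NonZero n}} → HasDegree (X ^ n + - 1#) n
  degree-Xⁿ-1 n@(suc _) =
    (λ eq → leading≉0 (degree-Xⁿ n) (≡.trans (≡.sym (coeff-above n z<s)) eq)) ,
    λ i n<i → ≡.trans (coeff-above i (ℕ.≤-<-trans z≤n n<i)) (degree≤ (degree-Xⁿ n) i n<i)
    where
    coeff-above : ∀ i → 0 < i → coeff (X ^ n + - 1#) i ≡ coeff (X ^ n) i
    coeff-above (suc i) _ = ≡.trans (coeff-⊕ (X ^ n) (- 1#) (suc i)) (ℤ.+-identityʳ _)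

  degree-∏ : ∀ (Φ : ℕ → Carrier) {ds} → All (λ d → HasDegree (Φ d) (φ d)) ds →
             HasDegree (∏ (map Φ ds)) (sum (map φ ds))
  degree-∏ Φ []       = degree-1
  degree-∏ Φ (h ∷ hs) = degree-⊗ℤ (Φ _) _ h (degree-∏ Φ hs)

  -- Degrees add in ℤ[X], and inductively the proper divisors account for ∑ φ(d) of the degree n of
  -- Xⁿ - 1. What is left for `Φ n` is φ(n), by the divisor sum of the totient.
  degree-Φ : ∀ Φ → IsCyclotomic Φ → ∀ n → 1 ≤ n → HasDegree (Φ n) (φ n)
  degree-Φ Φ cyclotomic = <-rec _ step
    where
    step : ∀ n → (∀ {d} → d < n → 1 ≤ d → HasDegree (Φ d) (φ d)) → 1 ≤ n → HasDegree (Φ n) (φ n)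
    step n rec 1≤n = degree-n (≋[]-or-degree (ℤ._≟ ℤ.0ℤ) (Φ n))
      where
      instance
        n≢0 : NonZero n
        n≢0 = >-nonZero 1≤n
      P = ∏ (map Φ (properDivisors n))
      deg-P : HasDegree P (sum (map φ (properDivisors n)))
      deg-P = degree-∏ Φ (All-properDivisors n λ 1≤d d<n _ → rec d<n 1≤d)
      deg-P*Φn : HasDegree (P * Φ n) n
      deg-P*Φn = degree-cong (trans (sym (cyclotomic n)) (∏-divisors Φ n)) (degree-Xⁿ-1 n)
      degree-n : Φ n ≈ 0# ⊎ ∃[ d ] HasDegree (Φ n) d → HasDegree (Φ n) (φ n)
      -- A vanishing `Φ n` would make the whole product zero, although its coefficient at n is not.
      degree-n (inj₁ Φn≈0)     = contradiction
        (Poly._≋_.coeff≈ (trans (*-congˡ {P} Φn≈0) (zeroʳ P)) n) (leading≉0 deg-P*Φn)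
      degree-n (inj₂ (d , hd)) = ≡.subst (HasDegree (Φ n)) d≡φn hd
        where
        d≡φn : d ≡ φ n
        d≡φn = ℕ.+-cancelˡ-≡ (sum (map φ (properDivisors n))) d (φ n) (≡.trans
          (degree-unique (degree-⊗ℤ P (Φ n) deg-P hd) deg-P*Φn)
          (≡.sym (∑φ-properDivisors n)))

module CyclotomicForms (K : CommutativeRing c ℓ) (1+1≈0 : HasCharacteristic2 K)
                       {f : ℤ → CommutativeRing.Carrier K} (f-homo : IsHomomorphism ℤ.+-*-commutativeRing K f)
                       (Φ : ℕ → List ℤ) (cyclotomic : IsCyclotomic Φ) where
  open CommutativeRing K
  open Characteristic2 K 1+1≈0
  open SemiringExp semiring using (_^_; ^-homo-*; ^-congˡ)
  open CommutativeSemiringExp commutativeSemiring using (^-distrib-*)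
  open Product K
  open NaturalSolver commutativeSemiring using (solve; _:=_; _:*_)
  open SetoidReasoning setoid
  private
    module ZX = CommutativeRing ℤ[X]
    module ZXExp = SemiringExp ZX.semiring
    module ZXProduct = Product ℤ[X]

  -- The homogenisation of `Φ n` at (u, v), with `t` in the role of u/v; the lemmas use the ratio
  -- only through `t * v ≈ u`.
  form : Carrier → Carrier → ℕ → Carrier
  form t v n = v ^ φ n * eval₂ ℤ₀ rawRing f t (Φ n)

  module _ {t u v : Carrier} (tv≈u : t * v ≈ u) where
    open Evaluation ℤ.+-*-commutativeRing K f-homo t
    open RingMorphisms.IsRingHomomorphism evalₛ-homo

    evalₛ-Xⁿ : ∀ n → evalₛ (Poly.X ℤ₀ ZXExp.^ n) ≈ t ^ n
    evalₛ-Xⁿ zero    = 1#-homo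
    evalₛ-Xⁿ (suc n) = trans (*-homo (Poly.X ℤ₀) (Poly.X ℤ₀ ZXExp.^ n)) (*-cong evalₛ-X (evalₛ-Xⁿ n))

    -- Homogenisation is multiplicative: exponents of v add while evaluation at t respects products.
    ∏-form : ∀ ds → ∏ (map (form t v) ds) ≈ v ^ sum (map φ ds) * evalₛ (ZXProduct.∏ (map Φ ds))
    ∏-form []       = sym (trans (*-identityˡ _) 1#-homo)
    ∏-form (d ∷ ds) = begin
      form t v d * ∏ (map (form t v) ds)
        ≈⟨ *-congˡ (∏-form ds) ⟩
      v ^ φ d * evalₛ (Φ d) * (v ^ sum (map φ ds) * evalₛ (ZXProduct.∏ (map Φ ds)))
        ≈⟨ solve 4 (λ p q r s → p :* q :* (r :* s) := p :* r :* (q :* s)) refl _ _ _ _ ⟩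
      v ^ φ d * v ^ sum (map φ ds) * (evalₛ (Φ d) * evalₛ (ZXProduct.∏ (map Φ ds)))
        ≈⟨ *-cong (^-homo-* v (φ d) (sum (map φ ds))) (*-homo (Φ d) (ZXProduct.∏ (map Φ ds))) ⟨
      v ^ sum (map φ (d ∷ ds)) * evalₛ (ZXProduct.∏ (map Φ (d ∷ ds))) ∎

    ∏-form-divisors : ∀ n .{{_ : NonZero n}} → ∏ (map (form t v) (divisors n)) ≈ u ^ n + v ^ n
    ∏-form-divisors n = begin
      ∏ (map (form t v) (divisors n))
        ≈⟨ ∏-form (divisors n) ⟩
      v ^ sum (map φ (divisors n)) * evalₛ (ZXProduct.∏ (map Φ (divisors n)))
        ≈⟨ *-cong (reflexive (≡.cong (v ^_) (∑φ≡n n))) (⟦⟧-cong (cyclotomic n)) ⟩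
      v ^ n * evalₛ (Poly.X ℤ₀ ZXExp.^ n ZX.+ ZX.- ZX.1#)
        ≈⟨ *-congˡ (trans (+-homo (Poly.X ℤ₀ ZXExp.^ n) (ZX.- ZX.1#))
             (+-cong (evalₛ-Xⁿ n) (trans (-‿homo ZX.1#) (trans (-x≈x _) 1#-homo)))) ⟩
      v ^ n * (t ^ n + 1#)
        ≈⟨ distribˡ _ _ _ ⟩
      v ^ n * t ^ n + v ^ n * 1#
        ≈⟨ +-cong (trans (*-comm _ _) (trans (sym (^-distrib-* t v n)) (^-congˡ n tv≈u))) (*-identityʳ _) ⟩
      u ^ n + v ^ n ∎

  -- Both orders of the arguments give the same product αⁿ + βⁿ over the
  -- divisors of n, and the factors at proper divisors agree by induction.
  form-symmetric : (∀ {x y z} → ¬ (x ≈ 0#) → x * y ≈ x * z → y ≈ z) →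
    ∀ {α β t t′} → t * β ≈ α → t′ * α ≈ β → (∀ n → ¬ (2 ∣ n) → ¬ (α ^ n + β ^ n ≈ 0#)) →
    ∀ n → 1 ≤ n → ¬ (2 ∣ n) → form t β n ≈ form t′ α n
  form-symmetric cancel {α} {β} {t} {t′} tβ≈α t′α≈β nonzero = <-rec _ step
    where
    step : ∀ n → (∀ {d} → d < n → 1 ≤ d → ¬ (2 ∣ d) → form t β d ≈ form t′ α d) →
           1 ≤ n → ¬ (2 ∣ n) → form t β n ≈ form t′ α n
    step n rec 1≤n 2∤n = cancel P≉0 (begin
      P * form t β n                       ≈⟨ P*form ⟩
      α ^ n + β ^ n                        ≈⟨ +-comm _ _ ⟩
      β ^ n + α ^ n                        ≈⟨ ∏-form-divisors t′α≈β n ⟨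
      ∏ (map (form t′ α) (divisors n))     ≈⟨ ∏-divisors (form t′ α) n ⟩
      ∏ (map (form t′ α) (properDivisors n)) * form t′ α n
        ≈⟨ *-congʳ (∏-cong (All-properDivisors n λ 1≤d d<n d∣n →
             rec d<n 1≤d (λ 2∣d → 2∤n (∣-trans 2∣d d∣n)))) ⟨
      P * form t′ α n                      ∎)
      where
      instance
        n≢0 : NonZero n
        n≢0 = >-nonZero 1≤n
      P = ∏ (map (form t β) (properDivisors n))
      P*form : P * form t β n ≈ α ^ n + β ^ n
      P*form = trans (sym (∏-divisors (form t β) n)) (∏-form-divisors tβ≈α n)
      P≉0 : ¬ (P ≈ 0#)
      P≉0 P≈0 = nonzero n 2∤n (trans (sym P*form) (trans (*-congʳ P≈0) (zeroˡ _)))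

-- `Φhom` first reduces the coefficients of `Φ n` to F, whereas `form` evaluates the integral
-- polynomial directly; this reconciles the two.
eval₂-map : (Z : CommutativeRing c ℓ) (R : CommutativeRing c₁ ℓ₁) (S : CommutativeRing c₂ ℓ₂) →
            let module Z = CommutativeRing Z
                module R = CommutativeRing R
                module S = CommutativeRing S in
            (g : Z.Carrier → R.Carrier) (f : R.Carrier → S.Carrier) (s : S.Carrier) (p : List Z.Carrier) →
            eval₂ R.rawRing S.rawRing f s (map g p) ≡ eval₂ Z.rawRing S.rawRing (f ∘ g) s p
eval₂-map Z R S g f s []      = ≡.refl
eval₂-map Z R S g f s (a ∷ p) =
  ≡.cong (λ v → CommutativeRing._+_ S (f (g a)) (CommutativeRing._*_ S s v)) (eval₂-map Z R S g f s p)

-- Vieta's relations for the two roots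

module Vieta (K : Field c ℓ) (1+1≈0 : HasCharacteristic2 (Field.commutativeRing K))
             (b c′ α β : Field.Carrier K) where
  open Field K
  private
    K₀ = Field.commutativeRing K
    K[T] = PolynomialRing.polynomialRing K₀
    module KT = CommutativeRing K[T]
    module KTExp = SemiringExp KT.semiring
    T = Poly.X rawRing
    const′ = Poly.const rawRing
  open Characteristic2 K₀ 1+1≈0
  open FieldProperties K
  open NaturalSolver commutativeSemiring using (solve; _:=_; _:+_; _:*_; con)
  open SetoidReasoning (CommutativeRing.setoid K₀)

  module _ (factor : T KTExp.^ 2 KT.+ const′ b KT.* T KT.+ const′ c′
                     KT.≈ (T KT.+ KT.- const′ α) KT.* (T KT.+ KT.- const′ β)) where

    -- The factorisation is an identity in K[T]; its values at 0 and at α are what yields the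
    -- product and the sum of the roots.
    quadratic : ∀ x → x * x + b * x + c′ ≈ (x + α) * (x + β)
    quadratic x = begin
      x * x + b * x + c′
        ≈⟨ +-cong (+-cong (trans (E.*-homo T (T KTExp.^ 1)) (*-cong evalₛ-X
                    (trans (E.*-homo T KT.1#) (trans (*-cong evalₛ-X E.1#-homo) (*-identityʳ x)))))
                  (trans (E.*-homo (const′ b) T) (*-cong (evalₛ-const b) evalₛ-X)))
                  (evalₛ-const c′) ⟨
      evalₛ (T KTExp.^ 2) + evalₛ (const′ b KT.* T) + evalₛ (const′ c′)
        ≈⟨ trans (E.+-homo (T KTExp.^ 2 KT.+ const′ b KT.* T) (const′ c′))
                 (+-congʳ (E.+-homo (T KTExp.^ 2) (const′ b KT.* T))) ⟨
      evalₛ (T KTExp.^ 2 KT.+ const′ b KT.* T KT.+ const′ c′)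
        ≈⟨ E.⟦⟧-cong factor ⟩
      evalₛ ((T KT.+ KT.- const′ α) KT.* (T KT.+ KT.- const′ β))
        ≈⟨ trans (E.*-homo (T KT.+ KT.- const′ α) (T KT.+ KT.- const′ β)) (*-cong (linear α) (linear β)) ⟩
      (x + α) * (x + β) ∎
      where
      open Evaluation K₀ K₀ (Identity.isRingHomomorphism rawRing refl) x
      module E = RingMorphisms.IsRingHomomorphism evalₛ-homo
      linear : ∀ γ → evalₛ (T KT.+ KT.- const′ γ) ≈ x + γ
      linear γ = trans (E.+-homo T (KT.- const′ γ)) (+-cong evalₛ-X
        (trans (E.-‿homo (const′ γ)) (trans (-x≈x _) (evalₛ-const γ))))

    αβ≈c : α * β ≈ c′
    αβ≈c = begin
      α * β                   ≈⟨ solve 2 (λ α β → α :* β := (con 0 :+ α) :* (con 0 :+ β)) refl α β ⟩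
      (0# + α) * (0# + β)     ≈⟨ quadratic 0# ⟨
      0# * 0# + b * 0# + c′   ≈⟨ solve 2 (λ b c → con 0 :* con 0 :+ b :* con 0 :+ c := c) refl b c′ ⟩
      c′                      ∎

    -- At x = α the factored side vanishes. Substituting αβ for the constant term leaves α(α + β) =
    -- αb, from which α is cancelled.
    α+β≈b : ¬ (α ≈ 0#) → α + β ≈ b
    α+β≈b α≉0 = *-cancelˡ α α≉0 (x+y≈0⇒x≈y (begin
      α * (α + β) + α * b         ≈⟨ solve 3 (λ α β b → α :* (α :+ β) :+ α :* b := α :* α :+ b :* α :+ α :* β) refl α β b ⟩
      α * α + b * α + α * β       ≈⟨ +-congˡ αβ≈c ⟩
      α * α + b * α + c′          ≈⟨ quadratic α ⟩
      (α + α) * (α + β)           ≈⟨ *-congʳ (x+x≈0 α) ⟩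
      0# * (α + β)                ≈⟨ zeroˡ _ ⟩
      0#                          ∎))

-- Lucas atoms in the algebraic closure

module LucasAtom (F : Field c ℓ) (1+1≈0 : HasCharacteristic2 (Field.commutativeRing F))
                 (Ω : AlgebraicClosureOfRationalFunctions F c₁ ℓ₁ c₂ ℓ₂) where
  open AlgebraicClosureOfRationalFunctions Ω
  open Bivariate F
  open BivariateProperties F
  private
    K₀ = Field.commutativeRing K
    module R = CommutativeRing R
    module embed-mono = RingMorphisms.IsRingMonomorphism (Composition.isRingMonomorphism K.trans
      (IsFractionField.isRingMonomorphism isFractionField)
      (IsAlgebraicClosure.isRingMonomorphism isAlgebraicClosure))

  embed-homo : IsHomomorphism R K₀ embed
  embed-homo = embed-mono.isRingHomomorphism

  coefficient-homo : IsHomomorphism F₀ K₀ (embed ∘ scalar)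
  coefficient-homo = Composition.isRingHomomorphism K.trans scalar-homo embed-homo

  embed≉0 : ∀ {P} → ¬ (P R.≈ R.0#) → ¬ (embed P K.≈ K.0#)
  embed≉0 P≉0 embedP≈0 =
    P≉0 (embed-mono.injective (K.trans embedP≈0 (K.sym embed-mono.0#-homo)))

  1+1≈0ₖ : HasCharacteristic2 K₀
  1+1≈0ₖ = K.trans (K.sym (K.trans (coeff.+-homo (Field.1# F) (Field.1# F)) (K.+-cong coeff.1#-homo coeff.1#-homo)))
                   (K.trans (coeff.⟦⟧-cong 1+1≈0) coeff.0#-homo)
    where module coeff = RingMorphisms.IsRingHomomorphism coefficient-homo

  module _ (Φ : ℕ → ∣ ℤ₀ [X] ∣) (cyclotomic : IsCyclotomic Φ)
           (α β : K.Carrier) (roots : AreRoots α β) where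
    open FieldProperties K
    open Vieta K 1+1≈0ₖ (embed B) (embed C) α β
    open SemiringExp K.semiring using () renaming (_^_ to _^ₖ_)

    private
      f : ℤ → K.Carrier
      f = (embed ∘ scalar) ∘ fromℤ (Field.rawRing F)

      f-homo : IsHomomorphism ℤ.+-*-commutativeRing K₀ f
      f-homo = Composition.isRingHomomorphism K.trans
        (Characteristic2.fromℤ-homo F₀ 1+1≈0) coefficient-homo

      αβ≈C : α K.* β K.≈ embed C
      αβ≈C = αβ≈c roots

      α≉0 : ¬ (α K.≈ K.0#)
      α≉0 α≈0 = embed≉0 C≉0 (K.trans (K.sym αβ≈C) (K.trans (K.*-congʳ α≈0) (K.zeroˡ β)))

      β≉0 : ¬ (β K.≈ K.0#)
      β≉0 β≈0 = embed≉0 C≉0 (K.trans (K.sym αβ≈C) (K.trans (K.*-congˡ β≈0) (K.zeroʳ α)))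

      α+β≈B : α K.+ β K.≈ embed B
      α+β≈B = α+β≈b roots α≉0

      x/y*y≈x : ∀ x {y} → ¬ (y K.≈ K.0#) → (x K./ y) K.* y K.≈ x
      x/y*y≈x x {y} y≉0 = K.trans (K.*-assoc _ _ _)
        (K.trans (K.*-congˡ (K.trans (K.*-comm _ _) (K.⁻¹-inverse y y≉0))) (K.*-identityʳ x))

      αⁿ+βⁿ≉0 : ∀ n → ¬ (2 ∣ n) → ¬ ((α ^ₖ n) K.+ (β ^ₖ n) K.≈ K.0#)
      αⁿ+βⁿ≉0 n 2∤n eq = embed≉0 (𝒰-odd≉0 1+1≈0 n 2∤n) (x*y≈0⇒y≈0 (embed≉0 B≉0)
        (K.trans (K.sym (LucasCharacteristic2.binet K₀ 1+1≈0ₖ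
          (LucasSequence.homomorphic-image R K₀ embed-homo 𝒰-lucas) α+β≈B αβ≈C n)) eq))

      open CyclotomicForms K₀ 1+1≈0ₖ f-homo Φ cyclotomic using (form; form-symmetric)

      σₖ-homo : IsHomomorphism R K₀ (embed ∘ σ)
      σₖ-homo = Composition.isRingHomomorphism K.trans σ-homo embed-homo

      σₖ-B : embed (σ B) K.≈ embed B K.* embed B
      σₖ-B = K.trans (embed-mono.⟦⟧-cong {σ B} {B R.* B} σ-B) (embed-mono.*-homo B B)

      σₖ-C : embed (σ C) K.≈ embed C
      σₖ-C = embed-mono.⟦⟧-cong {σ C} {C} σ-C

      open EvenForms R K₀ 1+1≈0ₖ σₖ-homo
      -- The coordinates live in a copy of F[B,C] whose variable `B` is sent by `embed ∘ σ` to the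
      -- square of `embed B`.
      open Roots {B} {C} {embed B} {embed C} {α} {β} σₖ-B σₖ-C α+β≈B αβ≈C
        using (Conjugate; conj-form; conj-resp; self-conjugate∈σ)

    -- The atom is produced already as a value of `σ`, so existence and membership come from one
    -- witness; uniqueness is injectivity of `embed`.
    lucasAtom∈F[B²,C] : ∀ n → ¬ (2 ∣ n) → 1 < n → ∃[ Λ ] (IsLucasAtom Φ n α β Λ × (Λ ∈F[B²,C]))
    lucasAtom∈F[B²,C] n 2∤n 1<n with 2∣φ n 2∤n 1<n
    ... | divides k φn≡2k = σ s , atom , (s , R.refl)
      where
      1≤n = ℕ.<⇒≤ 1<n
      conjugate : Conjugate (form (α K./ β) β n) (form (β K./ α) α n)
      -- `conj-form` is entered at `i = 0` and `d = φ n`; the zeroth powers of α and β in front are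
      -- removed here.
      conjugate = conj-resp (K.*-identityˡ _) (K.*-identityˡ _)
        (conj-form ℤ.+-*-commutativeRing f-homo
          -- Integer coefficients become scalars of F, which `σ` fixes, so they are their own
          -- preimages.
          (λ z → scalar (fromℤ (Field.rawRing F) z) ,
                 embed-mono.⟦⟧-cong {σ (scalar _)} {scalar _} (σ-scalar (fromℤ (Field.rawRing F) z)))
          (x/y*y≈x α β≉0) (x/y*y≈x β α≉0) k (Φ n) (φ n) 0
          (CyclotomicDegree.degree≤ (CyclotomicDegree.degree-Φ Φ cyclotomic n 1≤n)) φn≡2k)
      form∈σ : ∃[ s ] embed (σ s) K.≈ form (α K./ β) β n
      form∈σ = self-conjugate∈σ (x*y≈0⇒y≈0 (embed≉0 B≉0)) conjugate
        (form-symmetric (*-cancelˡ _) (x/y*y≈x α β≉0) (x/y*y≈x β α≉0) αⁿ+βⁿ≉0 n 1≤n 2∤n)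
      s = proj₁ form∈σ
      embed-Λ : embed (σ s) K.≈ Φhom Φ n α β
      embed-Λ = K.trans (proj₂ form∈σ) (K.*-congˡ (K.reflexive (≡.sym
        (eval₂-map ℤ.+-*-commutativeRing F₀ K₀ (fromℤ (Field.rawRing F)) (embed ∘ scalar) (α K./ β) (Φ n)))))
      atom : IsLucasAtom Φ n α β (σ s)
      atom = record
        { embed-Λ = embed-Λ
        ; unique  = λ Λ′ embed-Λ′ → embed-mono.injective (K.trans embed-Λ′ (K.sym embed-Λ))
        }

open import Data.Nat.Base using (_^_)
open import Relation.Binary.PropositionalEquality using (setoid)

lemma5p8 : ∀ {c ℓ c₁ ℓ₁ c₂ ℓ₂ : Level}
    (q e : ℕ) → 1 ≤ e → q ≡ 2 ^ e →
    (F : Field c ℓ) → Inverse (Field.setoid F) (setoid (Fin q)) →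
    let open Bivariate F in
    (n : ℕ) → ¬ (2 ∣ n) → 1 < n →
    (𝒰 n ∈F[B²,C])
    ×
    ((Φ : ℕ → ∣ ℤ₀ [X] ∣) → IsCyclotomic Φ →
    (Ω : AlgebraicClosureOfRationalFunctions F c₁ ℓ₁ c₂ ℓ₂) →
    let open AlgebraicClosureOfRationalFunctions Ω in
    (α β : K.Carrier) → AreRoots α β →
    ∃[ Λ ] (IsLucasAtom Φ n α β Λ × (Λ ∈F[B²,C])))
lemma5p8 q e 1≤e q≡2^e F F↔Fin n 2∤n 1<n =
  BivariateProperties.𝒰-odd∈F[B²,C] F n 2∤n ,
  λ Φ cyclotomic Ω α β roots →
    LucasAtom.lucasAtom∈F[B²,C] F (FiniteField.q≡2^e⇒1+1≈0 F F↔Fin e q≡2^e) Ω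
      Φ cyclotomic α β roots n 2∤n 1<n
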